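{- Let $Q$ be an $(n,q)$-cactus with $q\ge 2$. Then (a) $n-2q+2\le\overrightarrow{rvc}(Q)\le n-2$; (b) $2n-3q+3\le\overrightarrow{trc}(Q)\le 2n-3$.
   Context: Digraphs are finite, without loops or multiple arcs. A cactus is a strongly connected oriented graph (no pair of opposite arcs) in which every arc belongs to exactly one directed cycle; its blocks are directed cycles. An $(n,q)$-cactus is a cactus with $n$ vertices and $q$ blocks (equivalently, it decomposes into $q$ directed cycles). $\overrightarrow{rvc}(D)$ is the minimum number of colours in a vertex-colouring such that every ordered pair $(x,y)$ of vertices is joined by a directed path whose internal vertices have distinct colours. $\overrightarrow{trc}(D)$ is the minimum number of colours in a total-colouring (of vertices and arcs) such that every ordered pair is joined by a directed path whose arcs and internal vertices all receive pairwise distinct colours. -}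

module Defs where

open import Data.Nat using (ℕ; _≤_)
open import Data.Fin using (Fin)
open import Data.Bool using (Bool; true)
open import Data.List using (List; []; _∷_; _++_; [_]; map; length)
open import Data.List.Relation.Unary.All using (All)
open import Data.List.Relation.Unary.Unique.Propositional using (Unique)
open import Data.List.Membership.Propositional using (_∈_)
open import Data.Product using (Σ; ∃; _×_; _,_; uncurry)
open import Relation.Binary.PropositionalEquality using (_≡_; _≢_)
open import Relation.Nullary using (¬_)

Digraph : ℕ → Set
Digraph n = Fin n → Fin n → Bool

module _ {n : ℕ} (D : Digraph n) where

  Arc : Fin n → Fin n → Set
  Arc u v = D u v ≡ true

pairs : {A : Set} → List A → List (A × A)
pairs [] = []
pairs (x ∷ []) = []
pairs (x ∷ y ∷ xs) = (x , y) ∷ pairs (y ∷ xs)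

pathVerts : {A : Set} → A → List A → A → List A
pathVerts x mid y = x ∷ (mid ++ [ y ])

cycleArcs : {A : Set} → List A → List (A × A)
cycleArcs [] = []
cycleArcs (x ∷ xs) = pairs (x ∷ (xs ++ [ x ]))

module _ {n : ℕ} (D : Digraph n) where

  IsPath : Fin n → Fin n → List (Fin n) → Set
  IsPath x y mid = Unique (pathVerts x mid y)
                 × All (uncurry (Arc D)) (pairs (pathVerts x mid y))

  Loopless : Set
  Loopless = ∀ v → ¬ Arc D v v

  Oriented : Set
  Oriented = ∀ u v → Arc D u v → ¬ Arc D v u

  StronglyConnected : Set
  StronglyConnected = ∀ x y → x ≢ y → ∃ λ mid → IsPath x y mid

  IsCycle : List (Fin n) → Set
  IsCycle C = 2 ≤ length C × Unique C × All (uncurry (Arc D)) (cycleArcs C)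

  -- two cycles are the same subgraph iff they have the same arc set
  SameArcs : List (Fin n) → List (Fin n) → Set
  SameArcs C C' = ∀ a b → ((a , b) ∈ cycleArcs C → (a , b) ∈ cycleArcs C')
                        × ((a , b) ∈ cycleArcs C' → (a , b) ∈ cycleArcs C)

  Cactus : Set
  Cactus = Loopless × Oriented × StronglyConnected
         × (∀ u v → Arc D u v → ∃ λ C → IsCycle C × (u , v) ∈ cycleArcs C)
         × (∀ u v C C' → IsCycle C → IsCycle C' → (u , v) ∈ cycleArcs C
              → (u , v) ∈ cycleArcs C' → SameArcs C C')

  -- D has exactly q directed cycles (= blocks, for a cactus)
  HasCycles : ℕ → Set
  HasCycles q = Σ (Fin q → List (Fin n)) λ C →
                  (∀ i → IsCycle (C i))
                × (∀ i j → SameArcs (C i) (C j) → i ≡ j)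
                × (∀ C' → IsCycle C' → ∃ λ i → SameArcs C' (C i))

  RVColouring : ℕ → Set
  RVColouring k = Σ (Fin n → Fin k) λ c →
    ∀ x y → x ≢ y → ∃ λ mid → IsPath x y mid × Unique (map c mid)

  TRColouring : ℕ → Set
  TRColouring k = Σ (Fin n → Fin k) λ cv → Σ (Fin n → Fin n → Fin k) λ ca →
    ∀ x y → x ≢ y → ∃ λ mid → IsPath x y mid
      × Unique (map (uncurry ca) (pairs (pathVerts x mid y)) ++ map cv mid)

{-# OPTIONS --safe #-}
module Submission where

-- In a cactus, two walks that leave x by different arcs and end in the same vertex cannot both
-- avoid x afterwards: a walk from that vertex back to x would close them to two cycles with a
-- common last arc. Together with its mirror image this "tree-likeness" determines, for all x and
-- y, which vertices and arcs lie on every walk from x to y.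
--
-- Lower bounds. Root the cactus at a cut vertex c with blocks c → f₁ ⋯ l₁ → c and
-- c → f₂ ⋯ l₂ → c. Discard, in every block, the two neighbours of the vertex at which the block
-- hangs from c, and the two arcs joining them to it, but keep l₁, l₁ → c, f₂ and c → f₂. Any two
-- of the remaining n − 2q + 2 vertices and n − q + 1 arcs lie on a common unique path (as internal
-- vertices or arcs), so they have different colours.
--
-- Upper bounds. Each of two branches at c contains a vertex, a resp. b, with a single out-arc back
-- towards c; no path leaves both a and b. Dually no path enters both u and v, for suitable u, v.
-- Identify a with b and u with v in the colouring of vertices by themselves; colour an arc by its
-- tail, with a and b identified.

open import Defs
open import Data.Nat using (ℕ; _≤_; _+_; _*_; _∸_)
open import Data.Product using (_×_)
open import Data.Bool using (true)
import Data.Bool.Properties as Bool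
open import Data.Empty using (⊥; ⊥-elim)
open import Data.Fin using (Fin; punchOut; splitAt; _↑ˡ_; _↑ʳ_)
import Data.Fin.Induction as Fin
import Data.Fin.Properties as Fin
open import Data.List using (List; []; _∷_; _++_; [_]; map; length; lookup; filter; allFin)
import Data.List.Membership.DecPropositional as DecMem
open import Data.List.Membership.Propositional using (_∈_)
import Data.List.Membership.Propositional.Properties as Mem
import Data.List.Properties as List
open import Data.List.Relation.Unary.All as All using (All; []; _∷_)
import Data.List.Relation.Unary.All.Properties as All
open import Data.List.Relation.Unary.AllPairs using ([]; _∷_)
open import Data.List.Relation.Unary.Any using (here; there; index)
import Data.List.Relation.Unary.Any.Properties as Any
open import Data.List.Relation.Unary.Unique.Propositional using (Unique)
import Data.List.Relation.Unary.Unique.Propositional.Properties as Unique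
open import Data.Nat using (zero; suc; s≤s; z≤n)
import Data.Nat.Properties as ℕ
import Data.Nat.Solver as ℕSolver
open import Data.Product using (∃; _,_; proj₁; proj₂; uncurry)
open import Data.Sum using (_⊎_; inj₁; inj₂)
open import Data.Unit using (⊤; tt)
open import Function using (_∘_)
open import Relation.Binary.Definitions using (DecidableEquality)
open import Relation.Binary.PropositionalEquality as ≡
  using (_≡_; _≢_; refl; sym; trans; cong; cong₂; subst)
open import Relation.Binary.Structures using (IsStrictPartialOrder)
open import Relation.Nullary using (¬_; Dec; yes; no; contradiction)
open import Relation.Nullary.Decidable using (map′; _×-dec_; ¬?; decidable-stable)

-- Walks avoiding a vertex or an arc

data Elem (n : ℕ) : Set where
  vtx : Fin n → Elem n
  arc : Fin n → Fin n → Elem n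

vtx-injective : ∀ {n} {u v : Fin n} → vtx u ≡ vtx v → u ≡ v
vtx-injective refl = refl

arc-injective : ∀ {n} {a b c d : Fin n} → arc a b ≡ arc c d → a ≡ c × b ≡ d
arc-injective refl = refl , refl

vtx≢arc : ∀ {n} {u a b : Fin n} → vtx u ≢ arc a b
vtx≢arc ()

arc≢vtx : ∀ {n} {u a b : Fin n} → arc a b ≢ vtx u
arc≢vtx ()

infix 4 _≟ₑ_

_≟ₑ_ : ∀ {n} → DecidableEquality (Elem n)
vtx u ≟ₑ vtx v = map′ (cong vtx) vtx-injective (u Fin.≟ v)
vtx u ≟ₑ arc a b = no vtx≢arc
arc a b ≟ₑ vtx u = no arc≢vtx
arc a b ≟ₑ arc c d =
  map′ (λ (p , q) → cong₂ arc p q) arc-injective (a Fin.≟ c ×-dec b Fin.≟ d)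

flip : ∀ {n} → Elem n → Elem n
flip (vtx v) = vtx v
flip (arc a b) = arc b a

flip-involutive : ∀ {n} (e : Elem n) → flip (flip e) ≡ e
flip-involutive (vtx v) = refl
flip-involutive (arc a b) = refl

flip-≢ : ∀ {n} {e f : Elem n} → e ≢ f → flip e ≢ flip f
flip-≢ {e = e} {f} e≢f eq =
  e≢f (trans (sym (flip-involutive e)) (trans (cong flip eq) (flip-involutive f)))

infixl 6 _∖_

_∖_ : ∀ {n} → (Elem n → Set) → Fin n → Elem n → Set
(A ∖ v) e = A e × e ≢ vtx v

infix 8 _ᵒ

_ᵒ : ∀ {n} → Digraph n → Digraph n
(D ᵒ) u v = D v u

-- Walks rather than paths, since these concatenate freely. The predicate `A` has to hold at both
-- ends too.
data Walk {n} (D : Digraph n) (A : Elem n → Set) : Fin n → Fin n → Set where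
  stop : ∀ {x} → A (vtx x) → Walk D A x x
  step : ∀ {x z y} → A (vtx x) → A (arc x z) → Arc D x z → Walk D A z y → Walk D A x y

Avoid : ∀ {n} → Digraph n → Elem n → Fin n → Fin n → Set
Avoid D e = Walk D (_≢ e)

module _ {n} {D : Digraph n} where

  infixr 5 _▻_

  _▻_ : ∀ {A x y z} → Walk D A x y → Walk D A y z → Walk D A x z
  stop _ ▻ w' = w'
  step ax az xz w ▻ w' = step ax az xz (w ▻ w')

  start-ok : ∀ {A x y} → Walk D A x y → A (vtx x)
  start-ok (stop a) = a
  start-ok (step a _ _ _) = a

  end-ok : ∀ {A x y} → Walk D A x y → A (vtx y)
  end-ok (stop a) = a
  end-ok (step _ _ _ w) = end-ok w

  hop : ∀ {A x y} → A (vtx x) → A (arc x y) → A (vtx y) → Arc D x y → Walk D A x y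
  hop ax axy ay xy = step ax axy xy (stop ay)

  mapWalk : ∀ {A B x y} → (∀ {e} → A e → B e) → Walk D A x y → Walk D B x y
  mapWalk f (stop a) = stop (f a)
  mapWalk f (step ax az xz w) = step (f ax) (f az) xz (mapWalk f w)

  reverse : ∀ {A x y} → Walk D A x y → Walk (D ᵒ) (A ∘ flip) y x
  reverse w = go w (stop (start-ok w))
    where
    go : ∀ {A x y z} → Walk D A x y → Walk (D ᵒ) (A ∘ flip) x z → Walk (D ᵒ) (A ∘ flip) y z
    go (stop _) acc = acc
    go (step ax az xz w) acc = go w (step (start-ok w) az xz acc)

  avoid-or-visit : ∀ {A x y} v → Walk D A x y →
    Walk D (A ∖ v) x y ⊎ (Walk D A x v × Walk D A v y)
  avoid-or-visit {x = x} v w with x Fin.≟ v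
  avoid-or-visit v w | yes refl = inj₂ (stop (start-ok w) , w)
  avoid-or-visit v (stop a) | no x≢v = inj₁ (stop (a , x≢v ∘ vtx-injective))
  avoid-or-visit v (step ax az xz w) | no x≢v with avoid-or-visit v w
  ... | inj₁ w' = inj₁ (step (ax , x≢v ∘ vtx-injective) (az , arc≢vtx) xz w')
  ... | inj₂ (w₁ , w₂) = inj₂ (step ax az xz w₁ , w₂)

  avoid-or-leave : ∀ {A x y} v → v ≢ y → Walk D A x y →
    Walk D (A ∖ v) x y ⊎ ∃ λ z → Arc D v z × A (arc v z) × Walk D (A ∖ v) z y
  avoid-or-leave v v≢y (stop a) = inj₁ (stop (a , v≢y ∘ sym ∘ vtx-injective))
  avoid-or-leave {x = x} v v≢y (step ax az xz w) with avoid-or-leave v v≢y w | x Fin.≟ v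
  ... | inj₂ r | _ = inj₂ r
  ... | inj₁ w' | yes refl = inj₂ (_ , xz , az , w')
  ... | inj₁ w' | no x≢v = inj₁ (step (ax , x≢v ∘ vtx-injective) (az , arc≢vtx) xz w')

  last-exit : ∀ {A x y} → x ≢ y → Walk D A x y →
    ∃ λ z → Arc D x z × A (arc x z) × Walk D (A ∖ x) z y
  last-exit {x = x} x≢y w with avoid-or-leave x x≢y w
  ... | inj₁ w' = contradiction refl (proj₂ (start-ok w'))
  ... | inj₂ r = r

  first-entry : ∀ {A x y} → x ≢ y → Walk D A x y →
    ∃ λ z → Arc D z y × A (arc z y) × Walk D (A ∖ y) x z
  first-entry x≢y (stop _) = contradiction refl x≢y
  first-entry {y = y} x≢y (step {z = z} ax az xz w) with z Fin.≟ y
  ... | yes refl = _ , xz , az , stop (ax , x≢y ∘ vtx-injective)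
  ... | no z≢y with first-entry z≢y w
  ... | t , ty , aty , w' = t , ty , aty , step (ax , x≢y ∘ vtx-injective) (az , arc≢vtx) xz w'

-- Reversal of arcs and tree-like digraphs

reverseAvoid : ∀ {n} {D : Digraph n} {e x y} → Avoid D e x y → Avoid (D ᵒ) (flip e) y x
reverseAvoid {e = e} w =
  mapWalk (λ {f} p eq → p (trans (cong flip eq) (flip-involutive e))) (reverse w)

unreverseAvoid : ∀ {n} {D : Digraph n} {e x y} → Avoid (D ᵒ) (flip e) y x → Avoid D e x y
unreverseAvoid {D = D} {e} {x} {y} w =
  subst (λ f → Avoid D f x y) (flip-involutive e) (reverseAvoid w)

-- What the bounds use about a cactus. The list is closed under reversing all arcs, so through `op`
-- each result about leaving a vertex gives one about entering it. The field `avoid?` makes case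
-- distinctions on the existence of walks constructive.
record TreeLike {n} (q : ℕ) (D : Digraph n) : Set where
  field
    loopless   : Loopless D
    oriented   : Oriented D
    connected  : ∀ x y → Walk D (λ _ → ⊤) x y
    out-unique : ∀ {x a b y} → Arc D x a → Arc D x b →
                 Avoid D (vtx x) a y → Avoid D (vtx x) b y → a ≡ b
    in-unique  : ∀ {x a b y} → Arc D a x → Arc D b x →
                 Avoid D (vtx x) y a → Avoid D (vtx x) y b → a ≡ b
    avoid?     : ∀ e x y → Dec (Avoid D e x y)
    block      : ∀ {a b} → Arc D a b → Fin q
    -- Both walks run along the common cycle b' → ⋯ → a → b → ⋯ → a' → b'.
    block-tail : ∀ {a b a' b'} (p : Arc D a b) (p' : Arc D a' b') → block p ≡ block p' →
                 arc a b ≢ arc a' b' → Avoid D (vtx a') b' a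
    block-head : ∀ {a b a' b'} (p : Arc D a b) (p' : Arc D a' b') → block p ≡ block p' →
                 arc a b ≢ arc a' b' → Avoid D (vtx b') b a'

op : ∀ {n q} {D : Digraph n} → TreeLike q D → TreeLike q (D ᵒ)
op {D = D} S = record
  { loopless = loopless
  ; oriented = λ u v → oriented v u
  ; connected = λ x y → mapWalk _ (reverse (connected y x))
  ; out-unique = λ xa xb w w' → in-unique xa xb (reverseAvoid w) (reverseAvoid w')
  ; in-unique = λ ax bx w w' → out-unique ax bx (reverseAvoid w) (reverseAvoid w')
  ; avoid? = λ e x y → map′
      (subst (λ f → Avoid (D ᵒ) f x y) (flip-involutive e) ∘ reverseAvoid)
      reverseAvoid (avoid? (flip e) y x)
  ; block = block
  ; block-tail = λ p p' eq distinct → reverseAvoid (block-head p p' eq (flip-≢ distinct))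
  ; block-head = λ p p' eq distinct → reverseAvoid (block-tail p p' eq (flip-≢ distinct))
  }
  where open TreeLike S

-- Separation and conflict

Separates : ∀ {n} → Digraph n → Elem n → Fin n → Fin n → Set
Separates D e x y = vtx x ≢ e × vtx y ≢ e × ¬ Avoid D e x y

separates-op : ∀ {n} {D : Digraph n} {e x y} → Separates D e x y → Separates (D ᵒ) (flip e) y x
separates-op {D = D} {e} {x} {y} (x≢ , y≢ , ¬w) = flip-≢ y≢ , flip-≢ x≢ ,
  ¬w ∘ subst (λ f → Avoid D f x y) (flip-involutive e) ∘ reverseAvoid

-- Every path from `x` to `y` contains both elements as arcs or internal vertices, the ends being
-- excluded. A colouring must therefore tell distinct conflicting elements apart.
Conflict : ∀ {n} → Digraph n → Elem n → Elem n → Set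
Conflict D e f = ∃ λ x → ∃ λ y → Separates D e x y × Separates D f x y

conflict-sym : ∀ {n} {D : Digraph n} {e f} → Conflict D e f → Conflict D f e
conflict-sym (x , y , s , t) = x , y , t , s

conflict-op : ∀ {n} {D : Digraph n} {e f} → Conflict (D ᵒ) (flip e) (flip f) → Conflict D e f
conflict-op {D = D} {e} {f} (x , y , s , t) = y , x ,
  subst (λ g → Separates D g y x) (flip-involutive e) (separates-op s) ,
  subst (λ g → Separates D g y x) (flip-involutive f) (separates-op t)

module Basic {n q} {D : Digraph n} (S : TreeLike q D) where
  open TreeLike S

  arc⇒≢ : ∀ {u v} → Arc D u v → u ≢ v
  arc⇒≢ uv refl = loopless _ uv

  exit : ∀ {v c} → v ≢ c → ∃ λ s → Arc D v s × Avoid D (vtx v) s c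
  exit {v} {c} v≢c with last-exit v≢c (connected v c)
  ... | s , vs , _ , w = s , vs , mapWalk proj₂ w

  entry : ∀ {c v} → c ≢ v → ∃ λ d → Arc D d v × Avoid D (vtx v) c d
  entry {c} {v} c≢v with first-entry c≢v (connected c v)
  ... | d , dv , _ , w = d , dv , mapWalk proj₂ w

  ∖-avoid : ∀ {e v x y} → Walk D ((_≢ e) ∖ v) x y → Avoid D e x y
  ∖-avoid = mapWalk proj₁

  -- After its last departure from `v` the given walk reaches `c` off `v`, and so does the walk from
  -- `s`; `out-unique` identifies the two successors.
  exit-unique : ∀ {e v s c} → Arc D v s → Avoid D (vtx v) s c → v ≢ c → Avoid D e v c →
                arc v s ≢ e × Walk D ((_≢ e) ∖ v) s c
  exit-unique vs w v≢c w' with last-exit v≢c w'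
  ... | z , vz , z-ok , w″ with out-unique vs vz w (mapWalk proj₂ w″)
  ... | refl = z-ok , w″

  -- Every walk from x to c visits v, and leaves v for the last time through s.
  separator-exit : ∀ {d v s x c} → Arc D v s → Avoid D (vtx v) s c → v ≢ c →
    ¬ Avoid D (vtx v) x c → Avoid D d x c → Avoid D d s c
  separator-exit {v = v} vs w v≢c ¬w' w″ with avoid-or-visit v w″
  ... | inj₁ w‴ = contradiction (mapWalk proj₂ w‴) ¬w'
  ... | inj₂ (_ , w‴) = ∖-avoid (proj₂ (exit-unique vs w v≢c w‴))

  cut-walk : ∀ {e x y} c → ¬ Avoid D (vtx c) x y → Avoid D e x y → Avoid D e x c × Avoid D e c y
  cut-walk c ¬w w with avoid-or-visit c w
  ... | inj₁ w' = contradiction (mapWalk proj₂ w') ¬w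
  ... | inj₂ r = r

  -- On a walk from `d` to `c`, whichever of `d` and `d'` is visited last reaches `c` without the
  -- other.
  not-mutual : ∀ {d d' c} → d ≢ d' → ¬ Avoid D (vtx d) d' c → ¬ Avoid D (vtx d') d c → ⊥
  not-mutual {d} {d'} {c} d≢d' ¬w ¬w' with d Fin.≟ c
  ... | yes refl = ¬w' (stop (d≢d' ∘ vtx-injective))
  ... | no d≢c with d' Fin.≟ c
  ... | yes refl = ¬w (stop (d≢d' ∘ sym ∘ vtx-injective))
  ... | no d'≢c with last-exit d≢c (connected d c)
  ... | s , ds , _ , w with avoid-or-leave d' d'≢c w
  ... | inj₁ w' = ¬w' (step (d≢d' ∘ vtx-injective) arc≢vtx ds (mapWalk proj₂ w'))
  ... | inj₂ (t , dt , _ , w') =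
    ¬w (step (d≢d' ∘ sym ∘ vtx-injective) arc≢vtx dt (mapWalk (proj₂ ∘ proj₁) w'))

  -- A walk from `u` to `c` off `d` would force every walk from `d` to `c` to leave `d` for the last
  -- time through `u`, yet one of them avoids `u`.
  first-vertex-separates : ∀ {d u c} → Arc D d u → Avoid D (vtx u) d c → ¬ Avoid D (vtx d) u c
  first-vertex-separates {d} {u} {c} du w w' with d Fin.≟ c
  ... | yes refl = end-ok w' refl
  ... | no d≢c with exit-unique du w' d≢c w
  ... | _ , w″ = proj₁ (start-ok w″) refl

-- Normal elements

-- x and y are the predecessor of e on walks from c and its successor on walks to c, if e is a
-- vertex, and the ends of e, if e is an arc.
record Normal {n} (D : Digraph n) (c : Fin n) (e : Elem n) (x y : Fin n) : Set where
  field
    ends-distinct : x ≢ y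
    cuts-out      : Separates D e x c
    cuts-in       : Separates D e c y
    out-through   : ∀ {d} → Avoid D d x c → Avoid D d y c
    in-through    : ∀ {d} → Avoid D d c y → Avoid D d c x
    off-root      : Avoid D (vtx c) x y

open Normal

normal-op : ∀ {n} {D : Digraph n} {c e x y} → Normal D c e x y → Normal (D ᵒ) c (flip e) y x
normal-op N = record
  { ends-distinct = ends-distinct N ∘ sym
  ; cuts-out = separates-op (cuts-in N)
  ; cuts-in = separates-op (cuts-out N)
  ; out-through = unreverseAvoid ∘ in-through N ∘ reverseAvoid
  ; in-through = unreverseAvoid ∘ out-through N ∘ reverseAvoid
  ; off-root = reverseAvoid (off-root N)
  }

-- By `out-through`, `e` lies on every walk from `x'` to `c`, so the pair `(x', c)` serves. If `e`
-- is the vertex `x'` itself, `(c, y')` serves, because walks from `c` to `y'` come through `x'`.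
conflict-below : ∀ {n} {D : Digraph n} {c e e' x y x' y'} →
  Normal D c e x y → Normal D c e' x' y' → ¬ Avoid D e y' c → Conflict D e e'
conflict-below {c = c} {e} {x' = x'} {y'} N N' ¬w with vtx x' ≟ₑ e
... | no x'≢e = x' , c ,
  (x'≢e , proj₁ (proj₂ (cuts-out N)) , ¬w ∘ out-through N') , cuts-out N'
... | yes refl = c , y' ,
  (proj₁ (proj₂ (cuts-out N)) , ends-distinct N' ∘ sym ∘ vtx-injective ,
    λ w → end-ok (in-through N' w) refl) , cuts-in N'

-- If neither `conflict-below` nor its mirror image applies, the pair `(x, y')` serves. A walk from
-- `x` to `y'` extends to `c` without meeting `e` again, so it contains `e`; it can be preceded by a
-- walk from `c` off `e'`, so it contains `e'`.
normal-normal : ∀ {n q} {D : Digraph n} → TreeLike q D → ∀ {c e e' x y x' y'} →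
  Normal D c e x y → Normal D c e' x' y' → Conflict D e e'
normal-normal S {c} {e} {e'} {x} {y} {x'} {y'} N N'
  with TreeLike.avoid? S e y' c | TreeLike.avoid? S e' c x
... | no ¬w | _ = conflict-below N N' ¬w
... | yes _ | no ¬w =
  conflict-op (conflict-sym (conflict-below (normal-op N') (normal-op N) (¬w ∘ unreverseAvoid)))
... | yes w | yes w' = x , y' ,
  (proj₁ (cuts-out N) , start-ok w , λ v → proj₂ (proj₂ (cuts-out N)) (v ▻ w)) ,
  (end-ok w' , proj₁ (proj₂ (cuts-in N')) , λ v → proj₂ (proj₂ (cuts-in N')) (w' ▻ v))

module NormalElements {n q} {D : Digraph n} (S : TreeLike q D) where
  open TreeLike S
  open Basic S

  -- The last two hypotheses say that, in its block, `v` neither follows nor precedes the vertex at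
  -- which the block hangs from `c`.
  normal-vertex : ∀ {c d v s} → v ≢ c → Arc D d v → Avoid D (vtx v) c d →
    Arc D v s → Avoid D (vtx v) s c → ¬ Avoid D (vtx v) d c → ¬ Avoid D (vtx v) c s →
    Normal D c (vtx v) d s
  normal-vertex {c} {d} {v} {s} v≢c dv cd vs sc ¬dc ¬cs = record
    { ends-distinct = λ { refl → oriented d v dv vs }
    ; cuts-out = arc⇒≢ dv ∘ vtx-injective , v≢c ∘ sym ∘ vtx-injective , ¬dc
    ; cuts-in = v≢c ∘ sym ∘ vtx-injective , arc⇒≢ vs ∘ sym ∘ vtx-injective , ¬cs
    ; out-through = separator-exit vs sc v≢c ¬dc
    ; in-through = λ w → unreverseAvoid (Basic.separator-exit (op S) dv (reverseAvoid cd) v≢c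
        (¬cs ∘ unreverseAvoid) (reverseAvoid w))
    ; off-root = step (λ { refl → ¬dc (stop (start-ok cd)) }) arc≢vtx dv
        (hop (v≢c ∘ vtx-injective) arc≢vtx (λ { refl → ¬cs (stop (start-ok sc)) }) vs)
    }

  normal-arc : ∀ {c v s} → v ≢ c → Arc D v s → Avoid D (vtx v) s c →
    ¬ Avoid D (vtx v) c s → Normal D c (arc v s) v s
  normal-arc {c} {v} {s} v≢c vs sc ¬cs = record
    { ends-distinct = arc⇒≢ vs
    ; cuts-out = vtx≢arc , vtx≢arc , λ w → proj₁ (exit-unique vs sc v≢c w) refl
    ; cuts-in = vtx≢arc , vtx≢arc , through-arc
    ; out-through = λ w → ∖-avoid (proj₂ (exit-unique vs sc v≢c w))
    ; in-through = through-v
    ; off-root = hop (v≢c ∘ vtx-injective) arc≢vtx (λ { refl → ¬cs (stop (start-ok sc)) }) vs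
    }
    where
    through-arc : ¬ Avoid D (arc v s) c s
    through-arc w with avoid-or-leave v (arc⇒≢ vs) w
    ... | inj₁ w' = ¬cs (mapWalk proj₂ w')
    ... | inj₂ (z , vz , vz≢vs , w')
      with out-unique vz vs (mapWalk proj₂ w') (stop (arc⇒≢ vs ∘ sym ∘ vtx-injective))
    ... | refl = vz≢vs refl
    through-v : ∀ {d} → Avoid D d c s → Avoid D d c v
    through-v w with avoid-or-visit v w
    ... | inj₁ w' = contradiction (mapWalk proj₂ w') ¬cs
    ... | inj₂ (w' , _) = w'

-- Two branches at the root c: walks c → f₁ → ⋯ → d → l₁ → c and c → f₂ → s → ⋯ → l₂ → c.
record Branches {n} (D : Digraph n) (c f₁ d l₁ f₂ s l₂ : Fin n) : Set where
  field
    cf₁ : Arc D c f₁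
    dl₁ : Arc D d l₁
    l₁c : Arc D l₁ c
    cf₂ : Arc D c f₂
    f₂s : Arc D f₂ s
    l₂c : Arc D l₂ c
    f₁d : Avoid D (vtx c) f₁ d
    sl₂ : Avoid D (vtx c) s l₂
    f₁≢f₂ : f₁ ≢ f₂
    l₁≢l₂ : l₁ ≢ l₂

-- Reversal swaps the roles of the branches: facts about `l₁` and `l₁ → c` become facts about `f₂`
-- and `c → f₂`.
branches-op : ∀ {n} {D : Digraph n} {c f₁ d l₁ f₂ s l₂} →
  Branches D c f₁ d l₁ f₂ s l₂ → Branches (D ᵒ) c l₂ s f₂ l₁ d f₁
branches-op B = record
  { cf₁ = l₂c ; dl₁ = f₂s ; l₁c = cf₂ ; cf₂ = l₁c ; f₂s = dl₁ ; l₂c = cf₁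
  ; f₁d = reverseAvoid sl₂ ; sl₂ = reverseAvoid f₁d
  ; f₁≢f₂ = l₁≢l₂ ∘ sym ; l₁≢l₂ = f₁≢f₂ ∘ sym }
  where open Branches B

data Closing {n} (l c : Fin n) : Elem n → Set where
  vertex  : Closing l c (vtx l)
  the-arc : Closing l c (arc l c)

module TwoBranches {n q} {D : Digraph n} (S : TreeLike q D)
  {c f₁ d l₁ f₂ s l₂} (B : Branches D c f₁ d l₁ f₂ s l₂) where
  open TreeLike S
  open Basic S
  open Branches B

  d-l₁ : Avoid D (vtx c) d l₁
  d-l₁ = hop (end-ok f₁d) arc≢vtx (arc⇒≢ l₁c ∘ vtx-injective) dl₁

  ¬both : ∀ {x} → Avoid D (vtx c) x l₁ → ¬ Avoid D (vtx c) x l₂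
  ¬both w w' = l₁≢l₂ (in-unique l₁c l₂c w w')

  s≢l₁ : s ≢ l₁
  s≢l₁ refl = ¬both (stop (start-ok sl₂)) sl₂

  -- By `in-unique`, every walk from such an `x` enters `c` for the first time along `l₁ → c`.
  closing-separates : ∀ {e x} → Closing l₁ c e → Avoid D (vtx c) x l₁ → vtx x ≢ e →
    Separates D e x c
  closing-separates {e} {x} cl w x≢e = x≢e , c≢ cl , λ w' → absurd cl (entering w')
    where
    c≢ : ∀ {e} → Closing l₁ c e → vtx c ≢ e
    c≢ vertex = arc⇒≢ l₁c ∘ sym ∘ vtx-injective
    c≢ the-arc ()
    entering : ∀ {e} → Avoid D e x c → arc l₁ c ≢ e × vtx l₁ ≢ e
    entering w' with first-entry (start-ok w ∘ cong vtx) w'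
    ... | z , zc , zc≢e , w″ with in-unique l₁c zc w (mapWalk proj₂ w″)
    ... | refl = zc≢e , proj₁ (end-ok w″)
    absurd : ∀ {e} → Closing l₁ c e → arc l₁ c ≢ e × vtx l₁ ≢ e → ⊥
    absurd vertex (_ , p) = p refl
    absurd the-arc (p , _) = p refl

  extend-out : ∀ {e x y} → Separates D e x c → ¬ Avoid D (vtx c) x y → vtx y ≢ e →
    Separates D e x y
  extend-out (x≢ , _ , ¬w) ¬b y≢ = x≢ , y≢ , ¬w ∘ proj₁ ∘ cut-walk c ¬b

  extend-in : ∀ {e x y} → Separates D e c y → ¬ Avoid D (vtx c) x y → vtx x ≢ e →
    Separates D e x y
  extend-in (_ , y≢ , ¬w) ¬b x≢ = x≢ , y≢ , ¬w ∘ proj₂ ∘ cut-walk c ¬b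

  ¬d-s : ¬ Avoid D (vtx c) d s
  ¬d-s w = ¬both d-l₁ (w ▻ sl₂)

  closing-d-s : ∀ {e} → Closing l₁ c e → Separates D e d s
  closing-d-s cl = extend-out (closing-separates cl d-l₁ (d≢ cl)) ¬d-s (s≢ cl)
    where
    d≢ : ∀ {e} → Closing l₁ c e → vtx d ≢ e
    d≢ vertex = arc⇒≢ dl₁ ∘ vtx-injective
    d≢ the-arc ()
    s≢ : ∀ {e} → Closing l₁ c e → vtx s ≢ e
    s≢ vertex = s≢l₁ ∘ vtx-injective
    s≢ the-arc ()

  root-d-s : Separates D (vtx c) d s
  root-d-s = start-ok d-l₁ , start-ok sl₂ , ¬d-s

  module _ {e x y} (N : Normal D c e x y) where

    -- Here `x` lies in the branch of `l₁`, so a walk from `x` to `s` passes through `c` and has met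
    -- `e` by then. The case that `e` is `s` is excluded by a walk through `l₁` to `c` that bypasses
    -- `s`.
    normal-in-branch : Avoid D (vtx c) x l₁ → ¬ Avoid D (vtx c) x s × Separates D e x s
    normal-in-branch w = ¬x-s , extend-out (cuts-out N) ¬x-s λ { refl → s-bypassed (cuts-out N) }
      where
      ¬x-s : ¬ Avoid D (vtx c) x s
      ¬x-s w' = ¬both w (w' ▻ sl₂)
      s-bypassed : ¬ Separates D (vtx s) x c
      s-bypassed (_ , c≢s , ¬w) with avoid-or-visit s w
      ... | inj₁ w' = ¬w (mapWalk proj₂ w' ▻
        hop (proj₂ (end-ok w')) arc≢vtx c≢s l₁c)
      ... | inj₂ (w' , _) = ¬x-s w'

    -- If `d` reached `y` off `c`, then `y`, and with it `x`, would lead to `l₁` off `c`. Hence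
    -- walks from `d` to `y` pass through `c` and meet `e` after it.
    normal-off-branch : ¬ Avoid D (vtx c) x l₁ → ¬ Avoid D (vtx c) d y × Separates D e d y
    normal-off-branch ¬w = ¬d-y , extend-in (cuts-in N) ¬d-y λ { refl → d-bypassed (cuts-in N) }
      where
      ¬d-y : ¬ Avoid D (vtx c) d y
      ¬d-y w with entry {c = y} {v = c} (end-ok (off-root N) ∘ cong vtx)
      ... | z , zc , w' with in-unique l₁c zc d-l₁ (w ▻ w')
      ... | refl = ¬w (off-root N ▻ w')
      d-bypassed : ¬ Separates D (vtx d) c y
      d-bypassed (c≢d , _ , ¬w') with exit {v = c} (end-ok (off-root N) ∘ cong vtx ∘ sym)
      ... | z , cz , w with avoid-or-visit d w
      ... | inj₁ w″ = ¬w' (step c≢d arc≢vtx cz (mapWalk proj₂ w″))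
      ... | inj₂ (_ , w″) = ¬d-y w″

    root-normal : Conflict D (vtx c) e
    root-normal with avoid? (vtx c) x l₁
    ... | yes w with normal-in-branch w
    ... | ¬x-s , sep = x , s , (start-ok w , start-ok sl₂ , ¬x-s) , sep
    root-normal | no ¬w with normal-off-branch ¬w
    ... | ¬d-y , sep = d , y , (start-ok d-l₁ , end-ok (off-root N) , ¬d-y) , sep

    closing-normal : ∀ {f} → Closing l₁ c f → Conflict D f e
    closing-normal {f} cl with avoid? (vtx c) x l₁
    ... | no ¬w with normal-off-branch ¬w
    ... | ¬d-y , sep = d , y ,
      extend-out (closing-separates cl d-l₁ (proj₁ (closing-d-s cl))) ¬d-y (y≢ cl) , sep
      where
      y≢ : ∀ {f} → Closing l₁ c f → vtx y ≢ f
      y≢ vertex refl = ¬w (off-root N)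
      y≢ the-arc ()
    closing-normal {f} cl | yes w with vtx x ≟ₑ f
    ... | no x≢f with normal-in-branch w
    ... | ¬x-s , sep = x , s ,
      extend-out (closing-separates cl w x≢f) ¬x-s (proj₁ (proj₂ (closing-d-s cl))) , sep
    -- Now `l₁` is `x`, so no pair may start there. Walks from `c` to `y` come through `x` by
    -- `in-through`, so `(c, y)` serves.
    closing-normal {f} vertex | yes w | yes refl = c , y ,
      (start-ok w ∘ sym , ends-distinct N ∘ sym ∘ vtx-injective ,
        λ w' → end-ok (in-through N w') refl) , cuts-in N

-- Cliques of pairwise conflicting elements

lookup-injective : ∀ {A : Set} {xs : List A} → Unique xs →
  ∀ {i j} → lookup xs i ≡ lookup xs j → i ≡ j
lookup-injective (_ ∷ _) {Fin.zero} {Fin.zero} _ = refl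
lookup-injective {xs = _ ∷ xs} (x≢ ∷ _) {Fin.zero} {Fin.suc j} eq =
  contradiction eq (All.lookup x≢ (Mem.∈-lookup j))
lookup-injective {xs = _ ∷ xs} (x≢ ∷ _) {Fin.suc i} {Fin.zero} eq =
  contradiction (sym eq) (All.lookup x≢ (Mem.∈-lookup i))
lookup-injective (_ ∷ u) {Fin.suc i} {Fin.suc j} eq = cong Fin.suc (lookup-injective u eq)

-- The map `g` takes the membership proof because the block number of a vertex is computed from the
-- witness that it opens or closes a block.
unique⇒length≤ : ∀ {A : Set} {k} {xs : List A} → Unique xs → (g : ∀ {a} → a ∈ xs → Fin k) →
  (∀ {a b} (p : a ∈ xs) (q : b ∈ xs) → g p ≡ g q → a ≡ b) → length xs ≤ k
unique⇒length≤ u g g-inj =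
  Fin.injective⇒≤ {f = λ i → g (Mem.∈-lookup i)} λ eq → lookup-injective u (g-inj _ _ eq)

covering⇒≤length : ∀ {n} (xs : List (Fin n)) → (∀ v → v ∈ xs) → n ≤ length xs
covering⇒≤length xs cover = Fin.injective⇒≤ {f = λ v → index (cover v)} λ {u} {v} eq →
  trans (Any.lookup-index (cover u))
    (trans (cong (lookup xs) eq) (sym (Any.lookup-index (cover v))))

module Rooted {n q} {D : Digraph n} (S : TreeLike q D) (c : Fin n) where
  open TreeLike S
  open Basic S

  -- v is the successor, resp. predecessor, of the vertex at which its block hangs from the root.
  Opens Closes : Fin n → Set
  Opens v = ∃ λ d → Arc D d v × Avoid D (vtx v) c d × Avoid D (vtx v) d c
  Closes v = ∃ λ s → Arc D v s × Avoid D (vtx v) s c × Avoid D (vtx v) c s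

  opens? : ∀ v → Dec (Opens v)
  opens? v = Fin.any? λ d →
    (D d v Bool.≟ true) ×-dec avoid? (vtx v) c d ×-dec avoid? (vtx v) d c

  closes? : ∀ v → Dec (Closes v)
  closes? v = Fin.any? λ s →
    (D v s Bool.≟ true) ×-dec avoid? (vtx v) s c ×-dec avoid? (vtx v) c s

  opens-block : ∀ {v} → Opens v → Fin q
  opens-block (_ , dv , _) = block dv

  -- Two such vertices in one block would make their predecessors d, d' separate each other from c.
  opens-block-injective : ∀ {u v} (p : Opens u) (p' : Opens v) →
    opens-block p ≡ opens-block p' → u ≡ v
  opens-block-injective {u} {v} (d , du , _ , dc) (d' , d'v , _ , d'c) eq with u Fin.≟ v
  ... | yes u≡v = u≡v
  ... | no u≢v = ⊥-elim (not-mutual (λ { refl → end-ok v-d refl })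
        (first-vertex-separates du dc ∘ (u-d' ▻_))
        (first-vertex-separates d'v d'c ∘ (v-d ▻_)))
    where
    v-d : Avoid D (vtx d') v d
    v-d = block-tail du d'v eq (u≢v ∘ proj₂ ∘ arc-injective)
    u-d' : Avoid D (vtx d) u d'
    u-d' = block-tail d'v du (sym eq) (u≢v ∘ sym ∘ proj₂ ∘ arc-injective)

closes⇒opens-op : ∀ {n q} {D : Digraph n} (S : TreeLike q D) {c v} →
  Rooted.Closes S c v → Rooted.Opens (op S) c v
closes⇒opens-op S (s , vs , w , w') = s , vs , reverseAvoid w , reverseAvoid w'

module CliqueOf {n q} {D : Digraph n} (S : TreeLike q D)
  {c f₁ d l₁ f₂ s l₂} (B : Branches D c f₁ d l₁ f₂ s l₂) where
  open TreeLike S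
  open Basic S
  open Branches B
  open Rooted S c
  open TwoBranches S B
  open NormalElements S

  private module Opp = TwoBranches (op S) (branches-op B)

  data Clique (e : Elem n) : Set where
    root    : e ≡ vtx c → Clique e
    closing : Closing l₁ c e → Clique e
    opening : Closing f₂ c (flip e) → Clique e
    normal  : ∀ {x y} → Normal D c e x y → Clique e

  opening-d-s : ∀ {e} → Closing f₂ c (flip e) → Separates D e d s
  opening-d-s {e} cl =
    subst (λ f → Separates D f d s) (flip-involutive e) (separates-op (Opp.closing-d-s cl))

  opening-normal : ∀ {e f x y} → Closing f₂ c (flip f) → Normal D c e x y → Conflict D f e
  opening-normal cl N = conflict-op (Opp.closing-normal (normal-op N) cl)

  -- The three special kinds share one separated pair: every walk from `d` to `s` contains `l₁`,
  -- `l₁ → c`, `c`, `c → f₂` and `f₂`. So two special elements conflict without further cases.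
  special-or-normal : ∀ {e} → Clique e →
    (Separates D e d s × (∀ {f x y} → Normal D c f x y → Conflict D e f))
    ⊎ ∃ λ x → ∃ λ y → Normal D c e x y
  special-or-normal (root refl) = inj₁ (root-d-s , root-normal)
  special-or-normal (closing cl) = inj₁ (closing-d-s cl , λ N → closing-normal N cl)
  special-or-normal (opening cl) = inj₁ (opening-d-s cl , opening-normal cl)
  special-or-normal (normal N) = inj₂ (_ , _ , N)

  clique-conflict : ∀ {e f} → Clique e → Clique f → Conflict D e f
  clique-conflict p p' with special-or-normal p | special-or-normal p'
  ... | inj₁ (sep , _) | inj₁ (sep' , _) = d , s , sep , sep'
  ... | inj₁ (_ , conf) | inj₂ (_ , _ , N) = conf N
  ... | inj₂ (_ , _ , N) | inj₁ (_ , conf) = conflict-sym (conf N)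
  ... | inj₂ (_ , _ , N) | inj₂ (_ , _ , N') = normal-normal S N N'

  -- The retained arcs have distinct tails and can be counted by them: away from the root the arc is
  -- the one leading towards `c`, and the value `f₂` at `c` adds the retained arc `c → f₂`.
  next : Fin n → Fin n
  next v with v Fin.≟ c
  ... | yes _ = f₂
  ... | no v≢c = proj₁ (exit v≢c)

  next-exits : ∀ {v} → v ≢ c → Arc D v (next v) × Avoid D (vtx v) (next v) c
  next-exits {v} v≢c with v Fin.≟ c
  ... | yes v≡c = contradiction v≡c v≢c
  ... | no v≢c = proj₂ (exit v≢c)

  NormalTail NormalVertex : Fin n → Set
  NormalTail v = v ≢ c × ¬ Closes v
  NormalVertex v = ¬ Opens v × NormalTail v

  normalTail? : ∀ v → Dec (NormalTail v)
  normalTail? v = ¬? (v Fin.≟ c) ×-dec ¬? (closes? v)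

  normalVertex? : ∀ v → Dec (NormalVertex v)
  normalVertex? v = ¬? (opens? v) ×-dec normalTail? v

  normalTail-clique : ∀ {v} → NormalTail v → Clique (arc v (next v))
  normalTail-clique {v} (v≢c , ¬cl) with next-exits v≢c
  ... | vs , w = normal (normal-arc v≢c vs w λ w' → ¬cl (next v , vs , w , w'))

  normalVertex-clique : ∀ {v} → NormalVertex v → Clique (vtx v)
  normalVertex-clique (¬op , v≢c , ¬cl) with exit v≢c | entry (v≢c ∘ sym)
  ... | s , vs , sc | d , dv , cd = normal (normal-vertex v≢c dv cd vs sc
    (λ w → ¬op (d , dv , cd , w)) (λ w → ¬cl (s , vs , sc , w)))

  next-root : next c ≡ f₂
  next-root with c Fin.≟ c
  ... | yes _ = refl
  ... | no c≢c = contradiction refl c≢c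

  next-l₁ : next l₁ ≡ c
  next-l₁ with next-exits (arc⇒≢ l₁c)
  ... | l₁s , w = out-unique l₁s l₁c w (stop (arc⇒≢ l₁c ∘ sym ∘ vtx-injective))

  l₁-closes : Closes l₁
  l₁-closes = c , l₁c , stop c≢l₁ , stop c≢l₁
    where c≢l₁ = arc⇒≢ l₁c ∘ sym ∘ vtx-injective

  f₂-opens : Opens f₂
  f₂-opens = c , cf₂ , stop c≢f₂ , stop c≢f₂
    where c≢f₂ = arc⇒≢ cf₂ ∘ vtx-injective

  l₁≢f₂ : l₁ ≢ f₂
  l₁≢f₂ refl = ¬both (stop f₂≢c) (hop f₂≢c arc≢vtx (start-ok sl₂) f₂s ▻ sl₂)
    where f₂≢c = arc⇒≢ cf₂ ∘ sym ∘ vtx-injective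

  opening-vertices closing-vertices normal-vertices normal-tails : List (Fin n)
  opening-vertices = filter opens? (allFin n)
  closing-vertices = filter closes? (allFin n)
  normal-vertices = filter normalVertex? (allFin n)
  normal-tails = filter normalTail? (allFin n)

  opening≤q : length opening-vertices ≤ q
  opening≤q = unique⇒length≤ (Unique.filter⁺ opens? (Unique.allFin⁺ n))
    (opens-block ∘ opens) λ p p' → opens-block-injective (opens p) (opens p')
    where
    opens : ∀ {v} → v ∈ opening-vertices → Opens v
    opens = All.lookup (All.all-filter opens? (allFin n))

  closing≤q : length closing-vertices ≤ q
  closing≤q = unique⇒length≤ (Unique.filter⁺ closes? (Unique.allFin⁺ n))
    (Rooted.opens-block (op S) c ∘ closes)
    λ p p' → Rooted.opens-block-injective (op S) c (closes p) (closes p')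
    where
    closes : ∀ {v} → v ∈ closing-vertices → Rooted.Opens (op S) c v
    closes = closes⇒opens-op S ∘ All.lookup (All.all-filter closes? (allFin n))

  clique-vertices clique-tails : List (Fin n)
  clique-vertices = c ∷ l₁ ∷ f₂ ∷ normal-vertices
  clique-tails = c ∷ l₁ ∷ normal-tails

  clique-vertices-unique : Unique clique-vertices
  clique-vertices-unique =
    (arc⇒≢ l₁c ∘ sym ∷ arc⇒≢ cf₂ ∷ All.map (λ (_ , v≢c , _) → v≢c ∘ sym) normals)
    ∷ (l₁≢f₂ ∷ All.map (λ { (_ , _ , ¬cl) refl → ¬cl l₁-closes }) normals)
    ∷ All.map (λ { (¬op , _) refl → ¬op f₂-opens }) normals
    ∷ Unique.filter⁺ normalVertex? (Unique.allFin⁺ n)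
    where normals = All.all-filter normalVertex? (allFin n)

  clique-tails-unique : Unique clique-tails
  clique-tails-unique =
    (arc⇒≢ l₁c ∘ sym ∷ All.map (λ (v≢c , _) → v≢c ∘ sym) normals)
    ∷ All.map (λ { (_ , ¬cl) refl → ¬cl l₁-closes }) normals
    ∷ Unique.filter⁺ normalTail? (Unique.allFin⁺ n)
    where normals = All.all-filter normalTail? (allFin n)

  clique-vertices-clique : All (Clique ∘ vtx) clique-vertices
  clique-vertices-clique = root refl ∷ closing vertex ∷ opening vertex ∷
    All.map normalVertex-clique (All.all-filter normalVertex? (allFin n))

  clique-tails-clique : All (λ v → Clique (arc v (next v))) clique-tails
  clique-tails-clique =
    subst (λ v → Clique (arc c v)) (sym next-root) (opening the-arc) ∷
    subst (λ v → Clique (arc l₁ v)) (sym next-l₁) (closing the-arc) ∷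
    All.map normalTail-clique (All.all-filter normalTail? (allFin n))

  -- Besides `c`, each vertex is a normal tail or closes a block, and at most `q` do the latter. The
  -- extra 1 is `l₁`, which closes a block and is retained nevertheless.
  clique-tails-length : n + 1 ≤ length clique-tails + q
  clique-tails-length = begin
    n + 1 ≤⟨ ℕ.+-monoˡ-≤ 1 (covering⇒≤length (c ∷ normal-tails ++ closing-vertices) cover) ⟩
    suc (length (normal-tails ++ closing-vertices)) + 1
      ≡⟨ ℕ.+-comm (suc (length (normal-tails ++ closing-vertices))) 1 ⟩
    2 + length (normal-tails ++ closing-vertices)
      ≡⟨ cong (2 +_) (List.length-++ normal-tails) ⟩
    length clique-tails + length closing-vertices
      ≤⟨ ℕ.+-monoʳ-≤ (length clique-tails) closing≤q ⟩
    length clique-tails + q ∎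
    where
    open ℕ.≤-Reasoning
    cover : ∀ v → v ∈ c ∷ normal-tails ++ closing-vertices
    cover v with v Fin.≟ c | closes? v
    ... | yes v≡c | _ = here v≡c
    ... | no v≢c | yes cl =
      there (Mem.∈-++⁺ʳ normal-tails (Mem.∈-filter⁺ closes? (Mem.∈-allFin v) cl))
    ... | no v≢c | no ¬cl =
      there (Mem.∈-++⁺ˡ (Mem.∈-filter⁺ normalTail? (Mem.∈-allFin v) (v≢c , ¬cl)))

  -- The extra 2 comes from `l₁` and `f₂`, which are counted among the closing and the opening
  -- vertices and retained nevertheless.
  clique-vertices-length : n + 2 ≤ length clique-vertices + (q + q)
  clique-vertices-length = begin
    n + 2 ≤⟨ ℕ.+-monoˡ-≤ 2 (covering⇒≤length (c ∷ normal-vertices ++ others) cover) ⟩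
    suc (length (normal-vertices ++ others)) + 2
      ≡⟨ ℕ.+-comm (suc (length (normal-vertices ++ others))) 2 ⟩
    3 + length (normal-vertices ++ others)
      ≡⟨ cong (3 +_) (List.length-++ normal-vertices) ⟩
    length clique-vertices + length others
      ≡⟨ cong (length clique-vertices +_) (List.length-++ opening-vertices) ⟩
    length clique-vertices + (length opening-vertices + length closing-vertices)
      ≤⟨ ℕ.+-monoʳ-≤ (length clique-vertices) (ℕ.+-mono-≤ opening≤q closing≤q) ⟩
    length clique-vertices + (q + q) ∎
    where
    open ℕ.≤-Reasoning
    others = opening-vertices ++ closing-vertices
    cover : ∀ v → v ∈ c ∷ normal-vertices ++ others
    cover v with v Fin.≟ c | opens? v | closes? v
    ... | yes v≡c | _ | _ = here v≡c
    ... | no v≢c | yes o | _ = there (Mem.∈-++⁺ʳ normal-vertices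
      (Mem.∈-++⁺ˡ (Mem.∈-filter⁺ opens? (Mem.∈-allFin v) o)))
    ... | no v≢c | no ¬o | yes cl = there (Mem.∈-++⁺ʳ normal-vertices
      (Mem.∈-++⁺ʳ opening-vertices (Mem.∈-filter⁺ closes? (Mem.∈-allFin v) cl)))
    ... | no v≢c | no ¬o | no ¬cl =
      there (Mem.∈-++⁺ˡ (Mem.∈-filter⁺ normalVertex? (Mem.∈-allFin v) (¬o , v≢c , ¬cl)))

  vertex-clique-bound : ∀ {k} (col : Fin n → Fin k) →
    (∀ {u v} → Clique (vtx u) → Clique (vtx v) → col u ≡ col v → u ≡ v) →
    length clique-vertices ≤ k
  vertex-clique-bound col proper = unique⇒length≤ clique-vertices-unique (λ {v} _ → col v)
    λ p p' → proper (All.lookup clique-vertices-clique p) (All.lookup clique-vertices-clique p')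

  total-clique-bound : ∀ {k} (col : Elem n → Fin k) →
    (∀ {e f} → Clique e → Clique f → col e ≡ col f → e ≡ f) →
    length clique-vertices + length clique-tails ≤ k
  total-clique-bound {k} col proper = subst (_≤ k) lengths (unique⇒length≤ elems-unique
    (λ {e} _ → col e) λ p p' → proper (All.lookup elems-clique p) (All.lookup elems-clique p'))
    where
    tail-arc : Fin n → Elem n
    tail-arc v = arc v (next v)
    elems = map vtx clique-vertices ++ map tail-arc clique-tails
    lengths : length elems ≡ length clique-vertices + length clique-tails
    lengths = trans (List.length-++ (map vtx clique-vertices))
      (cong₂ _+_ (List.length-map vtx clique-vertices) (List.length-map tail-arc clique-tails))
    elems-clique : All Clique elems
    elems-clique = All.++⁺ (All.map⁺ clique-vertices-clique) (All.map⁺ clique-tails-clique)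
    disjoint : ∀ {e} → ¬ (e ∈ map vtx clique-vertices × e ∈ map tail-arc clique-tails)
    disjoint (p , p') with Mem.∈-map⁻ vtx p | Mem.∈-map⁻ tail-arc p'
    ... | _ , _ , refl | _ , _ , ()
    elems-unique : Unique elems
    elems-unique = Unique.++⁺ (Unique.map⁺ vtx-injective clique-vertices-unique)
      (Unique.map⁺ (proj₁ ∘ arc-injective) clique-tails-unique) disjoint

-- From conflicts to lower bounds

unique-map-injective : ∀ {A B : Set} {f : A → B} {xs} → Unique (map f xs) →
  ∀ {a b} → a ∈ xs → b ∈ xs → f a ≡ f b → a ≡ b
unique-map-injective (_ ∷ _) (here refl) (here refl) _ = refl
unique-map-injective {f = f} (≢s ∷ _) (here refl) (there q) eq =
  contradiction eq (All.lookup ≢s (Mem.∈-map⁺ f q))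
unique-map-injective {f = f} (≢s ∷ _) (there p) (here refl) eq =
  contradiction (sym eq) (All.lookup ≢s (Mem.∈-map⁺ f p))
unique-map-injective (_ ∷ u) (there p) (there q) eq = unique-map-injective u p q eq

-- Arcs precede internal vertices, so that applying `elem-colour` yields the very list of colours in
-- `TRColouring`.
path-elems : ∀ {n} → Fin n → List (Fin n) → Fin n → List (Elem n)
path-elems x mid y = map (uncurry arc) (pairs (pathVerts x mid y)) ++ map vtx mid

vtx∈path-elems : ∀ {n} {u x : Fin n} {mid y} → vtx u ∈ path-elems x mid y → u ∈ mid
vtx∈path-elems {x = x} {mid} {y} p
  with Mem.∈-++⁻ (map (uncurry arc) (pairs (pathVerts x mid y))) p
... | inj₁ p' with Mem.∈-map⁻ (uncurry arc) p'
... | _ , _ , ()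
vtx∈path-elems p | inj₂ p' with Mem.∈-map⁻ vtx p'
... | _ , u∈mid , refl = u∈mid

elem-colour : ∀ {n k} → (Fin n → Fin k) → (Fin n → Fin n → Fin k) → Elem n → Fin k
elem-colour cv ca (vtx v) = cv v
elem-colour cv ca (arc a b) = ca a b

module _ {n} {D : Digraph n} where

  path-walk : ∀ {A x y} mid → All (uncurry (Arc D)) (pairs (pathVerts x mid y)) →
    All (A ∘ uncurry arc) (pairs (pathVerts x mid y)) → A (vtx x) → All (A ∘ vtx) mid → A (vtx y) →
    Walk D A x y
  path-walk [] (xy ∷ []) (axy ∷ []) ax [] ay = hop ax axy ay xy
  path-walk (m ∷ mid) (xm ∷ arcs) (axm ∷ aas) ax (am ∷ ams) ay =
    step ax axm xm (path-walk mid arcs aas am ams ay)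

  -- Otherwise the path itself would be a walk avoiding `e`.
  separator∈path : ∀ {e x y mid} → Separates D e x y → IsPath D x y mid → e ∈ path-elems x mid y
  separator∈path {e} {x} {y} {mid} (x≢e , y≢e , ¬w) (_ , arcs)
    with DecMem._∈?_ _≟ₑ_ e (path-elems x mid y)
  ... | yes e∈ = e∈
  ... | no e∉ = contradiction (path-walk mid arcs
      (All.map⁻ (proj₁ avoids)) x≢e (All.map⁻ (proj₂ avoids)) y≢e) ¬w
    where
    avoids = All.++⁻ (map (uncurry arc) (pairs (pathVerts x mid y)))
      (All.map (_∘ sym) (All.¬Any⇒All¬ (path-elems x mid y) e∉))

  separated⇒≢ : ∀ {e x y} → Separates D e x y → x ≢ y
  separated⇒≢ (x≢e , _ , ¬w) refl = ¬w (stop x≢e)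

  rv-proper : ∀ {k} ((col , _) : RVColouring D k) {u v} → Conflict D (vtx u) (vtx v) →
    col u ≡ col v → u ≡ v
  rv-proper (col , paths) (x , y , sep , sep') with paths x y (separated⇒≢ sep)
  ... | mid , path , unique = unique-map-injective unique
    (vtx∈path-elems (separator∈path sep path)) (vtx∈path-elems (separator∈path sep' path))

  tr-proper : ∀ {k} ((cv , ca , _) : TRColouring D k) {e f} → Conflict D e f →
    elem-colour cv ca e ≡ elem-colour cv ca f → e ≡ f
  tr-proper (cv , ca , paths) (x , y , sep , sep') with paths x y (separated⇒≢ sep)
  ... | mid , path , unique = unique-map-injective (subst Unique (sym colours) unique)
    (separator∈path sep path) (separator∈path sep' path)
    where
    arcs = pairs (pathVerts x mid y)
    colours : map (elem-colour cv ca) (path-elems x mid y) ≡ map (uncurry ca) arcs ++ map cv mid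
    colours = trans (List.map-++ (elem-colour cv ca) (map (uncurry arc) arcs) (map vtx mid))
      (cong₂ _++_ (sym (List.map-∘ arcs)) (sym (List.map-∘ mid)))

module LowerBounds {n q} {D : Digraph n} (S : TreeLike q D)
  {c f₁ d l₁ f₂ s l₂} (B : Branches D c f₁ d l₁ f₂ s l₂) where
  open CliqueOf S B

  rv-lower : ∀ k → RVColouring D k → n + 2 ∸ 2 * q ≤ k
  rv-lower k col = ℕ.m≤n+o⇒m∸n≤o (n + 2) (2 * q) (begin
    n + 2 ≤⟨ clique-vertices-length ⟩
    length clique-vertices + (q + q) ≤⟨ ℕ.+-monoˡ-≤ (q + q)
      (vertex-clique-bound (proj₁ col) λ p p' → rv-proper col (clique-conflict p p')) ⟩
    k + (q + q) ≡⟨ solve 2 (λ k q → k :+ (q :+ q) := con 2 :* q :+ k) refl k q ⟩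
    2 * q + k ∎)
    where
    open ℕ.≤-Reasoning
    open ℕSolver.+-*-Solver

  tr-lower : ∀ k → TRColouring D k → 2 * n + 3 ∸ 3 * q ≤ k
  tr-lower k col@(cv , ca , _) = ℕ.m≤n+o⇒m∸n≤o (2 * n + 3) (3 * q) (begin
    2 * n + 3 ≡⟨ solve 1 (λ n → con 2 :* n :+ con 3 := (n :+ con 2) :+ (n :+ con 1)) refl n ⟩
    (n + 2) + (n + 1) ≤⟨ ℕ.+-mono-≤ clique-vertices-length clique-tails-length ⟩
    (a + (q + q)) + (b + q)
      ≡⟨ solve 3 (λ a b q → (a :+ (q :+ q)) :+ (b :+ q) := con 3 :* q :+ (a :+ b)) refl a b q ⟩
    3 * q + (a + b) ≤⟨ ℕ.+-monoʳ-≤ (3 * q)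
      (total-clique-bound (elem-colour cv ca) λ p p' → tr-proper col (clique-conflict p p')) ⟩
    3 * q + k ∎)
    where
    open ℕ.≤-Reasoning
    open ℕSolver.+-*-Solver
    a = length clique-vertices
    b = length clique-tails

-- Cacti are tree-like

-- Walks with their vertex list exposed, the start left out, so that repetition-free walks and
-- cycles can be expressed.
data Chain {n} (D : Digraph n) : Fin n → List (Fin n) → Fin n → Set where
  []  : ∀ {x} → Chain D x [] x
  _∷_ : ∀ {x z l y} → Arc D x z → Chain D z l y → Chain D x (z ∷ l) y

module _ {n} {D : Digraph n} where

  chain-suffix : ∀ {P : Fin n → Set} {s l y x} → Chain D s l y → Unique (s ∷ l) → All P (s ∷ l) →
    x ∈ s ∷ l → ∃ λ l' → Chain D x l' y × Unique (x ∷ l') × All P (x ∷ l')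
  chain-suffix ch u ps (here refl) = _ , ch , u , ps
  chain-suffix (_ ∷ ch) (_ ∷ u) (_ ∷ ps) (there p) = chain-suffix ch u ps p

  loop-erase : ∀ {A x y} → Walk D A x y →
    ∃ λ l → Chain D x l y × Unique (x ∷ l) × All (A ∘ vtx) (x ∷ l)
  loop-erase (stop a) = [] , [] , [] ∷ [] , a ∷ []
  loop-erase {x = x} (step {z = z} ax _ xz w) with loop-erase w
  ... | l , ch , u , as with DecMem._∈?_ Fin._≟_ x (z ∷ l)
  ... | yes x∈ = chain-suffix ch u as x∈
  ... | no x∉ = z ∷ l , xz ∷ ch , All.¬Any⇒All¬ (z ∷ l) x∉ ∷ u , ax ∷ as

  chain-avoid : ∀ {s l y r} → Chain D s l y → All (r ≢_) (s ∷ l) → Avoid D (vtx r) s y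
  chain-avoid [] (r≢s ∷ []) = stop (r≢s ∘ sym ∘ vtx-injective)
  chain-avoid (sz ∷ ch) (r≢s ∷ r≢) =
    step (r≢s ∘ sym ∘ vtx-injective) arc≢vtx sz (chain-avoid ch r≢)

  chain-end∈ : ∀ {s l y} → Chain D s l y → y ∈ s ∷ l
  chain-end∈ [] = here refl
  chain-end∈ (_ ∷ ch) = there (chain-end∈ ch)

  chain-arcs : ∀ {s l t r} → Chain D s l t → Arc D t r → All (uncurry (Arc D)) (pairs (s ∷ l ++ [ r ]))
  chain-arcs [] tr = tr ∷ []
  chain-arcs (sz ∷ ch) tr = sz ∷ chain-arcs ch tr

  closing-arc∈ : ∀ {s l t r} → Chain D s l t → (t , r) ∈ pairs (s ∷ l ++ [ r ])
  closing-arc∈ [] = here refl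
  closing-arc∈ (_ ∷ ch) = there (closing-arc∈ ch)

  arc-into-end : ∀ {s l t r b} → Chain D s l t → All (r ≢_) l → (b , r) ∈ pairs (s ∷ l ++ [ r ]) → b ≡ t
  arc-into-end [] _ (here refl) = refl
  arc-into-end (_ ∷ _) (r≢z ∷ _) (here refl) = contradiction refl r≢z
  arc-into-end (_ ∷ ch) (_ ∷ r≢) (there p) = arc-into-end ch r≢ p

  -- Apart from the closing arc `t → r`, every listed arc has its tail before `t`, which occurs only
  -- at the end. The stretch up to that tail is the walk that `block-tail` asks for.
  chain-before : ∀ {s l t r a b} → Chain D s l t → Unique (s ∷ l) → (a , b) ∈ pairs (s ∷ l ++ [ r ]) →
    arc a b ≡ arc t r ⊎ Avoid D (vtx t) s a
  chain-before [] _ (here refl) = inj₁ refl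
  chain-before (sz ∷ ch) (s≢ ∷ _) (here refl) =
    inj₂ (stop (All.lookup s≢ (chain-end∈ ch) ∘ vtx-injective))
  chain-before (sz ∷ ch) (s≢ ∷ u) (there p) with chain-before ch u p
  ... | inj₁ eq = inj₁ eq
  ... | inj₂ w = inj₂ (step (All.lookup s≢ (chain-end∈ ch) ∘ vtx-injective) arc≢vtx sz w)

  chain-after : ∀ {s l t r a b} → Chain D s l t → All (r ≢_) l → (a , b) ∈ pairs (s ∷ l ++ [ r ]) →
    arc a b ≡ arc t r ⊎ Avoid D (vtx r) b t
  chain-after [] _ (here refl) = inj₁ refl
  chain-after (_ ∷ ch) r≢ (here refl) = inj₂ (chain-avoid ch r≢)
  chain-after (_ ∷ ch) (_ ∷ r≢) (there p) = chain-after ch r≢ p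

  chain-cycle : ∀ {x a l z} → Chain D x (a ∷ l) z → Unique (x ∷ a ∷ l) → Arc D z x →
    IsCycle D (x ∷ a ∷ l)
  chain-cycle ch u zx = s≤s (s≤s z≤n) , u , chain-arcs ch zx

module _ {A : Set} where

  pairs-tail∈ : ∀ {p b : A} s l r → (p , b) ∈ pairs (s ∷ l ++ [ r ]) → p ∈ s ∷ l
  pairs-tail∈ s [] r (here refl) = here refl
  pairs-tail∈ s (z ∷ l) r (here refl) = here refl
  pairs-tail∈ s (z ∷ l) r (there p) = there (pairs-tail∈ z l r p)

  pairs-head∈ : ∀ {p b : A} s l r → (p , b) ∈ pairs (s ∷ l ++ [ r ]) → b ∈ r ∷ l
  pairs-head∈ s [] r (here refl) = here refl
  pairs-head∈ s (z ∷ l) r (here refl) = there (here refl)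
  pairs-head∈ s (z ∷ l) r (there p) with pairs-head∈ z l r p
  ... | here eq = here eq
  ... | there q = there (there q)

  pairs-successor : ∀ {u : A} s l r → u ∈ s ∷ l → ∃ λ u' → (u , u') ∈ pairs (s ∷ l ++ [ r ])
  pairs-successor s [] r (here refl) = r , here refl
  pairs-successor s (z ∷ l) r (here refl) = z , here refl
  pairs-successor s (z ∷ l) r (there p) with pairs-successor z l r p
  ... | u' , q = u' , there q

module CactusStructure {n q} {D : Digraph n} (cactus : Cactus D) (cycles : HasCycles D q) where

  private
    loopless : Loopless D
    loopless = proj₁ cactus
    oriented : Oriented D
    oriented = proj₁ (proj₂ cactus)
    strong : StronglyConnected D
    strong = proj₁ (proj₂ (proj₂ cactus))
    on-cycle : ∀ u v → Arc D u v → ∃ λ C → IsCycle D C × (u , v) ∈ cycleArcs C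
    on-cycle = proj₁ (proj₂ (proj₂ (proj₂ cactus)))
    same-cycle : ∀ u v C C' → IsCycle D C → IsCycle D C' → (u , v) ∈ cycleArcs C →
      (u , v) ∈ cycleArcs C' → SameArcs D C C'
    same-cycle = proj₂ (proj₂ (proj₂ (proj₂ cactus)))
    cyc : Fin q → List (Fin n)
    cyc = proj₁ cycles
    cyc-cycle : ∀ i → IsCycle D (cyc i)
    cyc-cycle = proj₁ (proj₂ cycles)

  connected : ∀ x y → Walk D (λ _ → ⊤) x y
  connected x y with x Fin.≟ y
  ... | yes refl = stop tt
  ... | no x≢y with strong x y x≢y
  ... | mid , _ , arcs = path-walk mid arcs (All.universal _ _) tt (All.universal _ _) tt

  off : ∀ {x : Fin n} {l} → All (λ v → vtx v ≢ vtx x) l → All (x ≢_) l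
  off = All.map (λ v≢x → v≢x ∘ cong vtx ∘ sym)

  -- A walk from y back to x closes both walks to cycles through x with the same last arc.
  out-unique : ∀ {x a b y} → Arc D x a → Arc D x b →
    Avoid D (vtx x) a y → Avoid D (vtx x) b y → a ≡ b
  out-unique {x} {a} {b} {y} xa xb w w' with first-entry (end-ok w ∘ cong vtx) (connected y x)
  ... | z , zx , _ , v with loop-erase (w ▻ mapWalk proj₂ v) | loop-erase (w' ▻ mapWalk proj₂ v)
  ... | l , ch , u , ≢x | l' , ch' , u' , ≢x' =
    sym (first-arc (proj₁ (same-cycle z x (x ∷ a ∷ l) (x ∷ b ∷ l')
      (chain-cycle (xa ∷ ch) (off ≢x ∷ u) zx) (chain-cycle (xb ∷ ch') (off ≢x' ∷ u') zx)
      (closing-arc∈ (xa ∷ ch)) (closing-arc∈ (xb ∷ ch')) x a) (here refl)))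
    where
    first-arc : (x , a) ∈ pairs (x ∷ b ∷ l' ++ [ x ]) → b ≡ a
    first-arc (here refl) = refl
    -- `x` does not recur on the cycle, so it is the tail of the first arc only.
    first-arc (there p) = contradiction refl (All.lookup (off ≢x') (pairs-tail∈ b l' x p))

  -- The mirror image: a walk from `x` to `y`, put before both walks, closes them to cycles with the
  -- same first arc `x → z`.
  in-unique : ∀ {x a b y} → Arc D a x → Arc D b x →
    Avoid D (vtx x) y a → Avoid D (vtx x) y b → a ≡ b
  in-unique {x} {a} {b} {y} ax bx w w' with last-exit (start-ok w ∘ cong vtx ∘ sym) (connected x y)
  ... | z , xz , _ , v with loop-erase (mapWalk proj₂ v ▻ w) | loop-erase (mapWalk proj₂ v ▻ w')
  ... | l , ch , u , ≢x | l' , ch' , u' , ≢x' =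
    arc-into-end (xz ∷ ch') (off ≢x') (proj₁ (same-cycle x z (x ∷ z ∷ l) (x ∷ z ∷ l')
      (chain-cycle (xz ∷ ch) (off ≢x ∷ u) ax) (chain-cycle (xz ∷ ch') (off ≢x' ∷ u') bx)
      (here refl) (here refl) a x) (closing-arc∈ (xz ∷ ch)))

  -- By `out-unique`, every walk from `x` to `y` last leaves `x` along the first arc of the chain.
  -- Inductively, `e` is avoidable only if the chain itself avoids it, so testing one path decides.
  chain-avoid? : ∀ e {x l y} → Chain D x l y → Unique (x ∷ l) → Dec (Avoid D e x y)
  chain-avoid? e {x} [] _ = map′ stop start-ok (¬? (vtx x ≟ₑ e))
  chain-avoid? e {x} {z ∷ l} {y} (xz ∷ ch) (x≢ ∷ u) =
    map′ (λ (x≢e , xz≢e , w) → step x≢e xz≢e xz w) (λ w → start-ok w , first-step w)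
      (¬? (vtx x ≟ₑ e) ×-dec ¬? (arc x z ≟ₑ e) ×-dec chain-avoid? e ch u)
    where
    first-step : Avoid D e x y → arc x z ≢ e × Avoid D e z y
    first-step w with last-exit (All.lookup x≢ (chain-end∈ ch)) w
    ... | t , xt , xt≢e , v with out-unique xt xz (mapWalk proj₂ v) (chain-avoid ch x≢)
    ... | refl = xt≢e , mapWalk proj₁ v

  avoid? : ∀ e x y → Dec (Avoid D e x y)
  avoid? e x y with loop-erase (connected x y)
  ... | l , ch , u , _ = chain-avoid? e ch u

  block : ∀ {a b} → Arc D a b → Fin q
  block {a} {b} ab with on-cycle a b ab
  ... | C , isC , _ = proj₁ (proj₂ (proj₂ (proj₂ cycles)) C isC)

  ∈block : ∀ {a b} (ab : Arc D a b) → (a , b) ∈ cycleArcs (cyc (block ab))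
  ∈block {a} {b} ab with on-cycle a b ab
  ... | C , isC , ab∈C = proj₁ (proj₂ (proj₂ (proj₂ (proj₂ cycles)) C isC) a b) ab∈C

  -- The loop-erased walk from `b` back to `a` closes to the cycle of `a → b`. It is listed from
  -- `b`, so that `a → b` comes last and `chain-before` and `chain-after` apply.
  block-chain : ∀ {a b} → Arc D a b → ∃ λ l → Chain D b l a × Unique (b ∷ l) ×
    (∀ {a' b'} (a'b' : Arc D a' b') (ab : Arc D a b) → block a'b' ≡ block ab →
      (a' , b') ∈ pairs (b ∷ l ++ [ b ]))
  block-chain {a} {b} ab with loop-erase (connected b a)
  ... | [] , [] , _ = contradiction ab (loopless a)
  ... | z ∷ l , ch , u , _ = z ∷ l , ch , u , λ {a'} {b'} a'b' ab' eq →
    proj₁ (same-cycle a b (cyc (block ab')) (b ∷ z ∷ l) (cyc-cycle _) (chain-cycle ch u ab)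
      (∈block ab') (closing-arc∈ ch) a' b')
      (subst (λ i → (a' , b') ∈ cycleArcs (cyc i)) eq (∈block a'b'))

  block-tail : ∀ {a b a' b'} (p : Arc D a b) (p' : Arc D a' b') → block p ≡ block p' →
    arc a b ≢ arc a' b' → Avoid D (vtx a') b' a
  block-tail p p' eq distinct with block-chain p'
  ... | _ , ch , u , mem with chain-before ch u (mem p p' eq)
  ... | inj₁ same = contradiction same distinct
  ... | inj₂ w = w

  block-head : ∀ {a b a' b'} (p : Arc D a b) (p' : Arc D a' b') → block p ≡ block p' →
    arc a b ≢ arc a' b' → Avoid D (vtx b') b a'
  block-head p p' eq distinct with block-chain p'
  ... | _ , ch , b'≢ ∷ _ , mem with chain-after ch b'≢ (mem p p' eq)
  ... | inj₁ same = contradiction same distinct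
  ... | inj₂ w = w

  treeLike : TreeLike q D
  treeLike = record
    { loopless = loopless ; oriented = oriented ; connected = connected
    ; out-unique = out-unique ; in-unique = in-unique ; avoid? = avoid?
    ; block = block ; block-tail = block-tail ; block-head = block-head }

  -- With a single arc out of each vertex, no walk leaves the cycle. By connectedness it contains
  -- every vertex, hence every arc.
  functional⇒all-arcs : (∀ {c a b} → Arc D c a → Arc D c b → a ≡ b) →
    ∀ {C} → IsCycle D C → ∀ {a b} → Arc D a b → (a , b) ∈ cycleArcs C
  functional⇒all-arcs functional {x ∷ xs} (_ , _ , arcs) {a} {b} ab
    with pairs-successor x xs x (reach (here refl) (connected x a))
    where
    reach : ∀ {u v} → u ∈ x ∷ xs → Walk D (λ _ → ⊤) u v → v ∈ x ∷ xs
    reach u∈ (stop _) = u∈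
    reach u∈ (step _ _ uz w) with pairs-successor x xs x u∈
    ... | u' , uu'∈ with functional uz (All.lookup arcs uu'∈)
    ... | refl = reach (pairs-head∈ x xs x uu'∈) w
  ... | a' , aa'∈ with functional ab (All.lookup arcs aa'∈)
  ... | refl = aa'∈

  Branching : Set
  Branching = ∃ λ c → ∃ λ f₁ → ∃ λ f₂ → Arc D c f₁ × Arc D c f₂ × f₁ ≢ f₂

  branching? : Dec Branching
  branching? = Fin.any? λ c → Fin.any? λ f₁ → Fin.any? λ f₂ →
    (D c f₁ Bool.≟ true) ×-dec (D c f₂ Bool.≟ true) ×-dec ¬? (f₁ Fin.≟ f₂)

  -- Without a branching vertex both cycles would contain all arcs and would coincide.
  branching : ∀ {i j : Fin q} → i ≢ j → Branching
  branching {i} {j} i≢j with branching?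
  ... | yes br = br
  ... | no ¬br = contradiction (proj₁ (proj₂ (proj₂ cycles)) i j
      λ a b → all-in j ∘ All.lookup (proj₂ (proj₂ (cyc-cycle i))) ,
        all-in i ∘ All.lookup (proj₂ (proj₂ (cyc-cycle j)))) i≢j
    where
    functional : ∀ {c a b} → Arc D c a → Arc D c b → a ≡ b
    functional {c} {a} {b} ca cb =
      decidable-stable (a Fin.≟ b) λ a≢b → ¬br (c , a , b , ca , cb , a≢b)
    all-in : ∀ i {a b} → Arc D a b → (a , b) ∈ cycleArcs (cyc i)
    all-in i = functional⇒all-arcs functional (cyc-cycle i)

branches : ∀ {n q} {D : Digraph n} → TreeLike q D → ∀ {c f₁ f₂} → Arc D c f₁ → Arc D c f₂ → f₁ ≢ f₂ →
  ∃ λ d → ∃ λ l₁ → ∃ λ s → ∃ λ l₂ → Branches D c f₁ d l₁ f₂ s l₂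
branches {D = D} S {c} {f₁} {f₂} cf₁ cf₂ f₁≢f₂
  with first-entry (Basic.arc⇒≢ S cf₁ ∘ sym) (TreeLike.connected S f₁ c)
     | first-entry (Basic.arc⇒≢ S cf₂ ∘ sym) (TreeLike.connected S f₂ c)
... | l₁ , l₁c , _ , w₁ | l₂ , l₂c , _ , w₂
  -- There are no 2-cycles, so `l₁` differs from `f₁` and `l₂` from `f₂`; this provides the inner
  -- vertices `d` and `s`.
  with first-entry (λ { refl → TreeLike.oriented S _ _ cf₁ l₁c }) w₁
     | last-exit (λ { refl → TreeLike.oriented S _ _ cf₂ l₂c }) w₂
... | d , dl₁ , _ , v₁ | s , f₂s , _ , v₂ = d , l₁ , s , l₂ , record
  { cf₁ = cf₁ ; dl₁ = dl₁ ; l₁c = l₁c ; cf₂ = cf₂ ; f₂s = f₂s ; l₂c = l₂c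
  ; f₁d = mapWalk (proj₂ ∘ proj₁) v₁ ; sl₂ = mapWalk (proj₂ ∘ proj₁) v₂
  ; f₁≢f₂ = f₁≢f₂
  ; l₁≢l₂ = λ { refl → f₁≢f₂ (TreeLike.out-unique S cf₁ cf₂ (mapWalk proj₂ w₁) (mapWalk proj₂ w₂)) }
  }

-- Colourings

-- In D ᵒ, a leaf is a vertex with a single predecessor; it is called a coleaf of D below.
record Leaf {n} (D : Digraph n) (c f l s : Fin n) : Set where
  field
    leaf-arc  : Arc D l s
    only-exit : ∀ {w} → Arc D l w → w ≡ s
    back      : Avoid D (vtx l) c s
    in-branch : Avoid D (vtx c) f l

open Leaf

module Leaves {n q} {D : Digraph n} (S : TreeLike q D) (c : Fin n) where
  open TreeLike S
  open Basic S

  -- Strict dominance in the flow graph with source `c`.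
  _≺_ : Fin n → Fin n → Set
  u ≺ v = u ≢ v × ¬ Avoid D (vtx u) c v

  ≺-trans : ∀ {u v w} → u ≺ v → v ≺ w → u ≺ w
  ≺-trans {u} {v} {w} (u≢v , ¬cv) (v≢w , ¬cw) = u≢w , ¬c-w
    where
    u≢w : u ≢ w
    u≢w refl = Basic.not-mutual (op S) u≢v (¬cv ∘ unreverseAvoid) (¬cw ∘ unreverseAvoid)
    ¬c-w : ¬ Avoid D (vtx u) c w
    ¬c-w cw with avoid-or-visit v cw
    ... | inj₁ cw' = ¬cw (mapWalk proj₂ cw')
    ... | inj₂ (cv , _) = ¬cv cv

  ≺-isStrictPartialOrder : IsStrictPartialOrder _≡_ _≺_
  ≺-isStrictPartialOrder = record
    { isEquivalence = ≡.isEquivalence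
    ; irrefl = λ u≡v u≺v → proj₁ u≺v u≡v
    ; trans = ≺-trans
    ; <-resp-≈ = ≡.resp₂ _≺_
    }

  -- A ≺-maximal vertex of a branch is a leaf.
  branch-leaf : ∀ {f} → c ≢ f → ∃ λ l → ∃ λ s → Leaf D c f l s
  branch-leaf {f} c≢f = search f (Fin.spo-noetherian ≺-isStrictPartialOrder f)
    (stop (c≢f ∘ sym ∘ vtx-injective))
    where
    search : ∀ v → Fin.Acc (λ u w → w ≺ u) v → Avoid D (vtx c) f v →
      ∃ λ l → ∃ λ s → Leaf D c f l s
    search v (Fin.acc rec) fv
      with Fin.any? (λ w → (D v w Bool.≟ true) ×-dec ¬? (avoid? (vtx v) c w))
    ... | yes (w , vw , ¬cw) = search w (rec (arc⇒≢ vw , ¬cw))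
      (fv ▻ hop (end-ok fv) arc≢vtx (λ { refl → ¬cw (stop (end-ok fv ∘ sym)) }) vw)
    ... | no none with exit {v} {c} (end-ok fv ∘ cong vtx) | entry {c} {v} (end-ok fv ∘ cong vtx ∘ sym)
    ... | s , vs , sc | d , dv , cd = v , s , record
      { leaf-arc = vs
      ; only-exit = λ vw → out-unique vw vs (returns vw) (returns vs)
      ; back = from-root vs
      ; in-branch = fv
      }
      where
      from-root : ∀ {w} → Arc D v w → Avoid D (vtx v) c w
      from-root {w} vw = decidable-stable (avoid? (vtx v) c w) λ ¬cw → none (w , vw , ¬cw)
      -- Each successor `w` of `v` is reached from `c` off `v`, so walks from `w` back to `v` first
      -- enter `v` through the same `d` as walks from `c`. All successors thus reach `d` off `v`,
      -- and `out-unique` makes them equal.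
      returns : ∀ {w} → Arc D v w → Avoid D (vtx v) w d
      returns {w} vw with first-entry (arc⇒≢ vw ∘ sym) (connected w v)
      ... | z , zv , _ , wz with in-unique zv dv (from-root vw ▻ mapWalk proj₂ wz) cd
      ... | refl = mapWalk proj₂ wz

  leaves-distinct : ∀ {f₁ f₂ l₁ l₂ s₁ s₂} → Arc D c f₁ → Arc D c f₂ → f₁ ≢ f₂ →
    Leaf D c f₁ l₁ s₁ → Leaf D c f₂ l₂ s₂ → l₁ ≢ l₂
  leaves-distinct cf₁ cf₂ f₁≢f₂ L₁ L₂ refl = f₁≢f₂ (out-unique cf₁ cf₂ (in-branch L₁) (in-branch L₂))

  -- A walk from `l₁` to `l₂` passes through `c`, and from there it needs `s₂` to reach `l₂`. A path
  -- that visits `l₁` and then `l₂` thus cannot continue, as `s₂` is the only exit.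
  leaf-cut : ∀ {f₁ f₂ l₁ l₂ s₁ s₂} → Arc D c f₁ → Arc D c f₂ → f₁ ≢ f₂ →
    Leaf D c f₁ l₁ s₁ → Leaf D c f₂ l₂ s₂ → ¬ Avoid D (vtx s₂) l₁ l₂
  leaf-cut cf₁ cf₂ f₁≢f₂ L₁ L₂ w = Basic.first-vertex-separates (op S) (leaf-arc L₂)
    (reverseAvoid (back L₂)) (reverseAvoid (proj₂ (cut-walk c ¬l₁-l₂ w)))
    where
    ¬l₁-l₂ : ¬ Avoid D (vtx c) _ _
    ¬l₁-l₂ w' = f₁≢f₂ (out-unique cf₁ cf₂ (in-branch L₁ ▻ w') (in-branch L₂))

  -- For a common vertex `v`, the walk from `p` over `c` to `s` avoids `v`, while `p → v → s` leaves
  -- `p` towards the same `s` through `v`, against `out-unique`.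
  leaf≢coleaf : ∀ {f l l' u s p} → Leaf D c f l s → Leaf (D ᵒ) c l' u p → l ≢ u
  leaf≢coleaf {l = v} {s = s} {p} L L' refl
    with last-exit (λ { refl → oriented v p (leaf-arc L) (leaf-arc L') })
           (unreverseAvoid {e = vtx v} (back L') ▻ back L)
  ... | z , pz , _ , w with out-unique pz (leaf-arc L') (mapWalk proj₂ w)
         (hop (arc⇒≢ (leaf-arc L') ∘ sym ∘ vtx-injective) arc≢vtx
           (proj₂ (end-ok w)) (leaf-arc L))
  ... | refl = proj₁ (start-ok w) refl

-- Paths through two leaves or two coleaves

module _ {n} {D : Digraph n} where

  path-chain : ∀ {x y} mid → All (uncurry (Arc D)) (pairs (pathVerts x mid y)) →
    Chain D x (mid ++ [ y ]) y
  path-chain [] (xy ∷ []) = xy ∷ []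
  path-chain (_ ∷ mid) (xm ∷ arcs) = xm ∷ path-chain mid arcs

  chain-to : ∀ {x l y r v} → Chain D x l y → All (r ≢_) (x ∷ l) → v ∈ x ∷ l → Avoid D (vtx r) x v
  chain-to _ (r≢x ∷ _) (here refl) = stop (r≢x ∘ sym ∘ vtx-injective)
  chain-to (xz ∷ ch) (r≢x ∷ r≢) (there v∈) =
    step (r≢x ∘ sym ∘ vtx-injective) arc≢vtx xz (chain-to ch r≢ v∈)

  chain-to-before : ∀ {x l y v s} → (∀ {w} → Arc D v w → w ≡ s) → Chain D x l y → Unique (x ∷ l) →
    v ∈ x ∷ l → v ≢ y → s ∈ l × Avoid D (vtx s) x v
  chain-to-before only [] _ (here refl) v≢y = contradiction refl v≢y
  chain-to-before only (vz ∷ _) ((v≢z ∷ _) ∷ _) (here refl) _ with only vz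
  ... | refl = here refl , stop (v≢z ∘ vtx-injective)
  chain-to-before only (xz ∷ ch) (x≢ ∷ u) (there v∈) v≢y with chain-to-before only ch u v∈ v≢y
  ... | s∈ , w = there s∈ , step (All.lookup x≢ (there s∈) ∘ vtx-injective) arc≢vtx xz w

  -- The only successor of the later of the two vertices comes after both, so the stretch between
  -- them avoids it.
  avoid-successor : ∀ {x l y u v s t} → (∀ {w} → Arc D u w → w ≡ s) → (∀ {w} → Arc D v w → w ≡ t) →
    Chain D x l y → Unique (x ∷ l) → u ∈ x ∷ l → v ∈ x ∷ l → u ≢ y → v ≢ y →
    Avoid D (vtx t) u v ⊎ Avoid D (vtx s) v u
  avoid-successor _ only-t ch u (here refl) v∈ _ v≢y =
    inj₁ (proj₂ (chain-to-before only-t ch u v∈ v≢y))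
  avoid-successor only-s _ ch u u∈@(there _) (here refl) u≢y _ =
    inj₂ (proj₂ (chain-to-before only-s ch u u∈ u≢y))
  avoid-successor only-s only-t (_ ∷ ch) (_ ∷ u) (there u∈) (there v∈) u≢y v≢y =
    avoid-successor only-s only-t ch u u∈ v∈ u≢y v≢y

  -- The only predecessor of the earlier of the two vertices comes before both, so the stretch
  -- between them avoids it.
  avoid-predecessor : ∀ {x l y u v p r} → (∀ {w} → Arc D w u → w ≡ p) → (∀ {w} → Arc D w v → w ≡ r) →
    u ≢ v → Chain D x l y → Unique (x ∷ l) → u ∈ l → v ∈ l →
    Avoid D (vtx p) u v ⊎ Avoid D (vtx r) v u
  avoid-predecessor _ _ u≢v _ _ (here refl) (here refl) = contradiction refl u≢v
  avoid-predecessor only-p _ _ (xu ∷ ch) (x≢ ∷ _) (here refl) (there v∈) with only-p xu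
  ... | refl = inj₁ (chain-to ch x≢ (there v∈))
  avoid-predecessor _ only-r _ (xv ∷ ch) (x≢ ∷ _) (there u∈) (here refl) with only-r xv
  ... | refl = inj₂ (chain-to ch x≢ (there u∈))
  avoid-predecessor only-p only-r u≢v (_ ∷ ch) (_ ∷ u) (there u∈) (there v∈) =
    avoid-predecessor only-p only-r u≢v ch u u∈ v∈

-- Colourings that identify two vertices

SamePair : {A : Set} → A → A → A → A → Set
SamePair a b x y = (x ≡ a × y ≡ b) ⊎ (x ≡ b × y ≡ a)

-- `punchOut` removes the value `a`, and `a` itself is sent to where `b` goes.
merge : ∀ {n} {a b : Fin (suc n)} → a ≢ b → Fin (suc n) → Fin n
merge {a = a} a≢b x with a Fin.≟ x
... | yes _ = punchOut a≢b
... | no a≢x = punchOut a≢x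

merge-collision : ∀ {n} {a b : Fin (suc n)} (a≢b : a ≢ b) {x y} →
  merge a≢b x ≡ merge a≢b y → x ≡ y ⊎ SamePair a b x y
merge-collision {a = a} a≢b {x} {y} eq with a Fin.≟ x | a Fin.≟ y
... | yes a≡x | yes a≡y = inj₁ (trans (sym a≡x) a≡y)
... | yes a≡x | no a≢y = inj₂ (inj₁ (sym a≡x , sym (Fin.punchOut-injective a≢b a≢y eq)))
... | no a≢x | yes a≡y = inj₂ (inj₂ (Fin.punchOut-injective a≢x a≢b eq , sym a≡y))
... | no a≢x | no a≢y = inj₁ (Fin.punchOut-injective a≢x a≢y eq)

unique-map-on : ∀ {A B : Set} {f : A → B} {xs} → Unique xs →
  (∀ {x y} → x ∈ xs → y ∈ xs → f x ≡ f y → x ≡ y) → Unique (map f xs)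
unique-map-on [] _ = []
unique-map-on (x≢ ∷ u) inj =
  All.map⁺ (All.tabulate λ y∈ eq → All.lookup x≢ y∈ (inj (here refl) (there y∈) eq))
  ∷ unique-map-on u λ p p' → inj (there p) (there p')

pairs-tails : ∀ {A : Set} (x : A) mid y → map proj₁ (pairs (pathVerts x mid y)) ≡ x ∷ mid
pairs-tails x [] y = refl
pairs-tails x (z ∷ mid) y = cong (x ∷_) (pairs-tails z mid y)

unique-init : ∀ {A : Set} (xs : List A) {y} → Unique (xs ++ [ y ]) → Unique xs × All (_≢ y) xs
unique-init [] _ = [] , []
unique-init (x ∷ xs) (x≢ ∷ u) with All.++⁻ xs x≢ | unique-init xs u
... | x≢xs , x≢y ∷ [] | u' , ≢y = x≢xs ∷ u' , x≢y ∷ ≢y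

module UpperBounds {m q} {D : Digraph (suc (suc m))} (S : TreeLike q D)
  (strong : StronglyConnected D) {c f₁ d l₁ f₂ z l₂} (B : Branches D c f₁ d l₁ f₂ z l₂)
  {a b s t u v p r}
  (L₁ : Leaf D c f₁ a s) (L₂ : Leaf D c f₂ b t)
  (K₁ : Leaf (D ᵒ) c l₁ u p) (K₂ : Leaf (D ᵒ) c l₂ v r) where
  open Branches B
  open Leaves S c

  a≢b : a ≢ b
  a≢b = leaves-distinct cf₁ cf₂ f₁≢f₂ L₁ L₂

  u≢v : u ≢ v
  u≢v = Leaves.leaves-distinct (op S) c l₁c l₂c l₁≢l₂ K₁ K₂

  not-both-leaves : ∀ {x y mid} → IsPath D x y mid → a ∈ x ∷ mid → b ∈ x ∷ mid → ⊥
  not-both-leaves {x} {y} {mid} (unique , arcs) a∈ b∈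
    with avoid-successor (only-exit L₁) (only-exit L₂) (path-chain mid arcs) unique
           (Mem.∈-++⁺ˡ a∈) (Mem.∈-++⁺ˡ b∈) (All.lookup ≢y a∈) (All.lookup ≢y b∈)
    where ≢y = proj₂ (unique-init (x ∷ mid) unique)
  ... | inj₁ w = leaf-cut cf₁ cf₂ f₁≢f₂ L₁ L₂ w
  ... | inj₂ w = leaf-cut cf₂ cf₁ (f₁≢f₂ ∘ sym) L₂ L₁ w

  not-both-coleaves : ∀ {x y mid} → IsPath D x y mid → u ∈ mid → v ∈ mid → ⊥
  not-both-coleaves {mid = mid} (unique , arcs) u∈ v∈
    with avoid-predecessor (only-exit K₁) (only-exit K₂) u≢v (path-chain mid arcs) unique
           (Mem.∈-++⁺ˡ u∈) (Mem.∈-++⁺ˡ v∈)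
  ... | inj₁ w = Leaves.leaf-cut (op S) c l₂c l₁c (l₁≢l₂ ∘ sym) K₂ K₁ (reverseAvoid w)
  ... | inj₂ w = Leaves.leaf-cut (op S) c l₁c l₂c l₁≢l₂ K₁ K₂ (reverseAvoid w)

  tail-colour : Fin (suc (suc m)) → Fin (suc m)
  tail-colour = merge a≢b

  -- No coleaf is a leaf, so `u` and `v` keep colours of their own when `a` and `b` are identified.
  -- The second `merge` therefore joins just `u` and `v`.
  tail-collision-coleaf : ∀ {w} x → w ≢ a → w ≢ b → tail-colour x ≡ tail-colour w → x ≡ w
  tail-collision-coleaf x w≢a w≢b eq with merge-collision a≢b eq
  ... | inj₁ x≡w = x≡w
  ... | inj₂ (inj₁ (_ , w≡b)) = contradiction w≡b w≢b
  ... | inj₂ (inj₂ (_ , w≡a)) = contradiction w≡a w≢a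

  u-colour : ∀ x → tail-colour x ≡ tail-colour u → x ≡ u
  u-colour x = tail-collision-coleaf x (leaf≢coleaf L₁ K₁ ∘ sym) (leaf≢coleaf L₂ K₁ ∘ sym)

  v-colour : ∀ x → tail-colour x ≡ tail-colour v → x ≡ v
  v-colour x = tail-collision-coleaf x (leaf≢coleaf L₁ K₂ ∘ sym) (leaf≢coleaf L₂ K₂ ∘ sym)

  vertex-colour : Fin (suc (suc m)) → Fin m
  vertex-colour = merge (u≢v ∘ v-colour u) ∘ tail-colour

  -- The arcs of the path have the tails `x ∷ mid`. The end `y` is left out, as a path may well pass
  -- one leaf and end in the other.
  tails-distinct : ∀ {x y mid} → IsPath D x y mid → Unique (map tail-colour (x ∷ mid))
  tails-distinct {x} {y} {mid} path = unique-map-on (proj₁ (unique-init (x ∷ mid) (proj₁ path)))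
    λ x∈ y∈ eq → collision x∈ y∈ (merge-collision a≢b eq)
    where
    collision : ∀ {i j} → i ∈ x ∷ mid → j ∈ x ∷ mid → i ≡ j ⊎ SamePair a b i j → i ≡ j
    collision _ _ (inj₁ eq) = eq
    collision i∈ j∈ (inj₂ (inj₁ (refl , refl))) = ⊥-elim (not-both-leaves path i∈ j∈)
    collision i∈ j∈ (inj₂ (inj₂ (refl , refl))) = ⊥-elim (not-both-leaves path j∈ i∈)

  interior-distinct : ∀ {x y mid} → IsPath D x y mid → Unique (map vertex-colour mid)
  interior-distinct {x} {y} {mid} path with unique-init (x ∷ mid) (proj₁ path) | tails-distinct path
  ... | _ ∷ unique , _ | _ ∷ tails = unique-map-on unique λ i∈ j∈ eq →
      collision i∈ j∈ (merge-collision (u≢v ∘ v-colour u) eq)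
    where
    collision : ∀ {i j} → i ∈ mid → j ∈ mid → tail-colour i ≡ tail-colour j
      ⊎ SamePair (tail-colour u) (tail-colour v) (tail-colour i) (tail-colour j) → i ≡ j
    collision i∈ j∈ (inj₁ eq) = unique-map-injective tails i∈ j∈ eq
    collision {i} {j} i∈ j∈ (inj₂ (inj₁ (eq , eq'))) with u-colour i eq | v-colour j eq'
    ... | refl | refl = ⊥-elim (not-both-coleaves path i∈ j∈)
    collision {i} {j} i∈ j∈ (inj₂ (inj₂ (eq , eq'))) with v-colour i eq | u-colour j eq'
    ... | refl | refl = ⊥-elim (not-both-coleaves path j∈ i∈)

  rv-upper : RVColouring D m
  rv-upper = vertex-colour , λ x y x≢y →
    let mid , path = strong x y x≢y in mid , path , interior-distinct path

  -- Internal vertices and arcs use disjoint palettes of `m` and `m + 1` colours, so each kind can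
  -- be checked by itself. With `n = m + 2` these are `2n - 3` colours.
  tr-upper : TRColouring D (m + suc m)
  tr-upper = cv , ca , λ x y x≢y →
    let mid , path = strong x y x≢y in mid , path ,
      Unique.++⁺ (arcs-distinct x mid y path)
        (subst Unique (sym (List.map-∘ mid))
          (Unique.map⁺ (Fin.↑ˡ-injective (suc m) _ _) (interior-distinct path)))
        (disjoint (pairs (pathVerts x mid y)) mid)
    where
    cv : Fin (suc (suc m)) → Fin (m + suc m)
    cv x = vertex-colour x ↑ˡ suc m
    ca : Fin (suc (suc m)) → Fin (suc (suc m)) → Fin (m + suc m)
    ca x _ = m ↑ʳ tail-colour x
    arcs-distinct : ∀ x mid y → IsPath D x y mid →
      Unique (map (uncurry ca) (pairs (pathVerts x mid y)))
    arcs-distinct x mid y path = subst Unique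
      (trans (sym (List.map-∘ (x ∷ mid)))
        (trans (cong (map (λ w → m ↑ʳ tail-colour w)) (sym (pairs-tails x mid y)))
          (sym (List.map-∘ (pairs (pathVerts x mid y))))))
      (Unique.map⁺ (Fin.↑ʳ-injective m _ _) (tails-distinct path))
    ↑ˡ≢↑ʳ : ∀ i j → i ↑ˡ suc m ≢ m ↑ʳ j
    ↑ˡ≢↑ʳ i j eq with trans (sym (Fin.splitAt-↑ˡ m i (suc m)))
                        (trans (cong (splitAt m) eq) (Fin.splitAt-↑ʳ m (suc m) j))
    ... | ()
    disjoint : ∀ arcs mid {k} → ¬ (k ∈ map (uncurry ca) arcs × k ∈ map cv mid)
    disjoint arcs mid (k∈ , k∈') with Mem.∈-map⁻ (uncurry ca) k∈ | Mem.∈-map⁻ cv k∈'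
    ... | (x , _) , _ , eq | y , _ , eq' =
      ↑ˡ≢↑ʳ (vertex-colour y) (tail-colour x) (trans (sym eq') eq)

-- Both pairs of bounds

cactus-bounds : ∀ {n q} {Q : Digraph n} → TreeLike q Q → StronglyConnected Q →
  ∀ {c f₁ d l₁ f₂ s l₂} → Branches Q c f₁ d l₁ f₂ s l₂ →
    ((∀ k → RVColouring Q k → n + 2 ∸ 2 * q ≤ k) × RVColouring Q (n ∸ 2))
    × ((∀ k → TRColouring Q k → 2 * n + 3 ∸ 3 * q ≤ k) × TRColouring Q (2 * n ∸ 3))
cactus-bounds {zero} _ _ {c = ()} _
cactus-bounds {suc zero} S _ {Fin.zero} {Fin.zero} B =
  contradiction (Branches.cf₁ B) (TreeLike.loopless S Fin.zero)
cactus-bounds {suc (suc m)} {Q = Q} S strong {c} {f₁} {l₁ = l₁} {f₂} {l₂ = l₂} B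
  with Leaves.branch-leaf S c (Basic.arc⇒≢ S cf₁) | Leaves.branch-leaf S c (Basic.arc⇒≢ S cf₂)
     | Leaves.branch-leaf (op S) c (Basic.arc⇒≢ S l₁c ∘ sym)
     | Leaves.branch-leaf (op S) c (Basic.arc⇒≢ S l₂c ∘ sym)
  where open Branches B
... | _ , _ , L₁ | _ , _ , L₂ | _ , _ , K₁ | _ , _ , K₂ =
  (rv-lower , rv-upper) , (tr-lower , subst (TRColouring Q) colours tr-upper)
  where
  open LowerBounds S B
  open UpperBounds S strong B L₁ L₂ K₁ K₂
  open ℕSolver.+-*-Solver
  colours : m + suc m ≡ 2 * suc (suc m) ∸ 3
  colours = sym (cong (_∸ 3) (solve 1 (λ m →
    con 2 :* (con 2 :+ m) := con 3 :+ (m :+ (con 1 :+ m))) refl m))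

theorem25 : ∀ {n q : ℕ} (Q : Digraph n) → Cactus Q → HasCycles Q q → 2 ≤ q →
    ((∀ k → RVColouring Q k → n + 2 ∸ 2 * q ≤ k) × RVColouring Q (n ∸ 2))
    × ((∀ k → TRColouring Q k → 2 * n + 3 ∸ 3 * q ≤ k) × TRColouring Q (2 * n ∸ 3))
theorem25 Q cactus cycles (s≤s (s≤s _))
  with CactusStructure.branching cactus cycles {Fin.zero} {Fin.suc Fin.zero} (λ ())
... | c , f₁ , f₂ , cf₁ , cf₂ , f₁≢f₂ with CactusStructure.treeLike cactus cycles
... | S with branches S cf₁ cf₂ f₁≢f₂
... | _ , _ , _ , _ , B = cactus-bounds S (proj₁ (proj₂ (proj₂ cactus))) B
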